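{- Let $G$ be the Cayley graph of the Coxeter system $\mathbf{B_n}$ ($n\ge2$) or $\mathbf{D_n}$ ($n\ge 3$) with respect to its standard Coxeter generators. Then $\sigma(G)\le\lceil\sqrt{\kappa(G)}\rceil+1$.
   Context: $\mathbf{B_n}$ is the Coxeter group with generators $s_1,\dots,s_n$ and relations $s_i^2=1$, $(s_1s_2)^4=1$, $(s_is_{i+1})^3=1$ for $2\le i\le n-1$, and $(s_is_j)^2=1$ for $|i-j|\ge2$. $\mathbf{D_n}$ is the Coxeter group with generators $s_1,\dots,s_n$ and relations $s_i^2=1$, $(s_1s_3)^3=(s_2s_3)^3=1$, $(s_is_{i+1})^3=1$ for $3\le i\le n-1$, and $(s_is_j)^2=1$ for all other pairs $i\ne j$. The Cayley graph has $x\sim y$ iff $x^{ -1}y$ is a generator. $\kappa(G)$ is the largest $d$ with the hypercube $Q_d$ a subgraph of $G$; $\sigma(G)$ is the minimum of the maximum degree of $G[K]$ over vertex sets $K$ with $|K|>\alpha(G)$, $\alpha$ the independence number. -}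

module Defs where

open import Data.Nat using (ℕ; zero; suc; _+_; _*_; _≤_; _<_)
open import Data.Fin using (Fin; toℕ)
open import Data.Bool using (Bool; not)
open import Data.Vec using (Vec; updateAt)
open import Data.List using (List; []; _∷_; _++_; [_]; length)
open import Data.List.Membership.Propositional using (_∈_)
open import Data.List.Relation.Unary.All using (All)
open import Data.List.Relation.Unary.AllPairs using (AllPairs)
open import Data.List.Relation.Binary.Sublist.Propositional using (_⊆_)
open import Data.Product using (Σ; _×_; ∃)
open import Relation.Nullary using (¬_)
open import Relation.Binary.PropositionalEquality using (_≡_)

-- Coxeter matrices.  Generator s_(k+1) is indexed by k : Fin n.

mA : ℕ → ℕ → ℕ
mA zero zero = 1
mA zero (suc zero) = 3
mA zero (suc (suc _)) = 2
mA (suc zero) zero = 3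
mA (suc (suc _)) zero = 2
mA (suc a) (suc b) = mA a b

mBℕ : ℕ → ℕ → ℕ
mBℕ zero zero = 1
mBℕ zero (suc zero) = 4
mBℕ zero (suc (suc _)) = 2
mBℕ (suc zero) zero = 4
mBℕ (suc (suc _)) zero = 2
mBℕ (suc a) (suc b) = mA a b

mDℕ : ℕ → ℕ → ℕ
mDℕ zero zero = 1
mDℕ zero (suc zero) = 2
mDℕ zero (suc (suc zero)) = 3
mDℕ zero (suc (suc (suc _))) = 2
mDℕ (suc zero) zero = 2
mDℕ (suc (suc zero)) zero = 3
mDℕ (suc (suc (suc _))) zero = 2
mDℕ (suc a) (suc b) = mA a b

mB : (n : ℕ) → Fin n → Fin n → ℕ
mB n i j = mBℕ (toℕ i) (toℕ j)

mD : (n : ℕ) → Fin n → Fin n → ℕ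
mD n i j = mDℕ (toℕ i) (toℕ j)

-- The Coxeter group given by the presentation <s_i | (s_i s_j)^{m_ij} = 1>,
-- realised as words in the generators modulo the congruence generated
-- by the relators (s_i s_j)^{m_ij} (which include s_i^2 as m_ii = 1).

Word : ℕ → Set
Word n = List (Fin n)

alt : {n : ℕ} → Fin n → Fin n → ℕ → Word n
alt i j zero = []
alt i j (suc k) = i ∷ alt j i k

data WordEq {n : ℕ} (m : Fin n → Fin n → ℕ) : Word n → Word n → Set where
  weq-refl  : ∀ {u} → WordEq m u u
  weq-sym   : ∀ {u v} → WordEq m u v → WordEq m v u
  weq-trans : ∀ {u v w} → WordEq m u v → WordEq m v w → WordEq m u w
  weq-rel   : ∀ u v i j → WordEq m (u ++ (alt i j (2 * m i j) ++ v)) (u ++ v)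

Adj : {n : ℕ} → (Fin n → Fin n → ℕ) → Word n → Word n → Set
Adj {n} m x y = Σ (Fin n) λ i → WordEq m y (x ++ [ i ])

-- a finite vertex set: a list of pairwise distinct group elements
Distinct : {n : ℕ} → (Fin n → Fin n → ℕ) → List (Word n) → Set
Distinct m K = AllPairs (λ a b → ¬ WordEq m a b) K

Independent : {n : ℕ} → (Fin n → Fin n → ℕ) → List (Word n) → Set
Independent m I = Distinct m I × AllPairs (λ a b → ¬ Adj m a b) I

-- maximum degree of the induced subgraph G[K] is at most c:
-- for every x in K, the neighbours of x inside K number at most c
MaxDegLe : {n : ℕ} → (Fin n → Fin n → ℕ) → List (Word n) → ℕ → Set
MaxDegLe m K c = ∀ x → x ∈ K → ∀ L → L ⊆ K → All (Adj m x) L → length L ≤ c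

ExceedsAlpha : {n : ℕ} → (Fin n → Fin n → ℕ) → List (Word n) → Set
ExceedsAlpha m K = Distinct m K × (∀ I → Independent m I → length I < length K)

SigmaLe : {n : ℕ} → (Fin n → Fin n → ℕ) → ℕ → Set
SigmaLe m c = ∃ λ K → ExceedsAlpha m K × MaxDegLe m K c

HypercubeAdj : {d : ℕ} → Vec Bool d → Vec Bool d → Set
HypercubeAdj {d} a b = Σ (Fin d) λ i → b ≡ updateAt a i not

HasHypercube : {n : ℕ} → (Fin n → Fin n → ℕ) → ℕ → Set
HasHypercube {n} m d =
  Σ (Vec Bool d → Word n) λ f →
    (∀ a b → WordEq m (f a) (f b) → a ≡ b) ×
    (∀ a b → HypercubeAdj a b → Adj m (f a) (f b))

IsKappa : {n : ℕ} → (Fin n → Fin n → ℕ) → ℕ → Set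
IsKappa m d = HasHypercube m d × (∀ d' → HasHypercube m d' → d' ≤ d)

IsCeilSqrt : ℕ → ℕ → Set
IsCeilSqrt d r = d ≤ r * r × (∀ r' → d ≤ r' * r' → r ≤ r')

Bound : {n : ℕ} → (Fin n → Fin n → ℕ) → Set
Bound m = ∀ d r → IsKappa m d → IsCeilSqrt d r → SigmaLe m (r + 1)

{-# OPTIONS --safe #-}
module Submission where

-- Right multiplication by generators acts on signed arrangements, and forgetting signs maps B_n and D_n to S_n.
-- Pair the values of an arrangement (up to one) and let bit j record the order in which the j-th pair occurs;
-- an adjacent transposition flips at most one bit, and different transpositions flip different bits.  With the
-- Chung–Füredi–Graham–Seymour function g on ⌊n/2⌋ bits, whose sensitivity is at most ⌈√⌊n/2⌋⌉, let K consist of the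
-- elements whose sign times (-1)^g is a fixed constant.  A neighbour inside K comes from a sensitive bit or from
-- generator 0, hence the degree bound.  Inserting the two largest values at all positions turns the signed sum of
-- (-1)^g over the group into a positive multiple of the alternating sum of (-1)^g over the cube, which is ±2,
-- so one of the two choices of K contains more than half of the group, whereas right multiplication by s_2
-- shows that an independent set contains at most half.  Finally κ ≥ ⌊n/2⌋ because of commuting generators.

open import Defs
open import Data.Nat using (ℕ; zero; suc; _≤_; _<_; _≥_; z≤n; s≤s; s≤s⁻¹; _+_; _*_; _∸_; _≟_; _≤?_; _<?_; _≤ᵇ_)
open import Data.Nat.Properties
open import Data.Bool as Bool using (Bool; true; false; not; if_then_else_; _xor_)
open import Data.Bool.Properties using (¬-not; not-¬; not-involutive; not-distribˡ-xor; xor-assoc; xor-comm)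
open import Data.Empty using (⊥; ⊥-elim)
open import Data.Fin using (Fin; zero; suc; toℕ; fromℕ<)
open import Data.Fin.Properties using (toℕ-injective; toℕ-fromℕ<; toℕ<n; fromℕ<-toℕ)
open import Data.Integer as ℤ using (ℤ; 0ℤ; 1ℤ; -1ℤ)
import Data.Integer.Properties as ℤP
open import Data.Integer.Tactic.RingSolver using (solve-∀)
open import Data.List using (List; []; _∷_; _++_; [_]; length; map; concatMap; filter; reverse;
  cartesianProduct; cartesianProductWith; applyUpTo; upTo)
open import Data.List.Membership.Propositional using (_∈_)
open import Data.List.Membership.Propositional.Properties using (∈-∃++; ∈-++⁻; ∈-++⁺ˡ; ∈-++⁺ʳ; ∈-map⁺; ∈-filter⁻;
  ∈-cartesianProduct⁺; ∈-cartesianProduct⁻; ∈-cartesianProductWith⁺; ∈-cartesianProductWith⁻; ∈-upTo⁺; ∈-upTo⁻)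
open import Data.List.Properties using (length-++; length-map; map-++; ++-assoc; ++-identityʳ; concatMap-++; unfold-reverse)
open import Data.List.Relation.Binary.Sublist.Propositional as Sub using (_⊆_)
open import Data.List.Relation.Binary.Sublist.Propositional.Properties using (All-resp-⊆)
open import Data.List.Relation.Unary.All as All using (All; []; _∷_)
import Data.List.Relation.Unary.All.Properties as AllP
open import Data.List.Relation.Unary.AllPairs as AllPairs using (AllPairs; []; _∷_)
import Data.List.Relation.Unary.AllPairs.Properties as AllPairsP
open import Data.List.Relation.Unary.Any using (here; there)
open import Data.List.Relation.Unary.Unique.Propositional using (Unique)
import Data.List.Relation.Unary.Unique.Propositional.Properties as UniqueP
open import Data.Maybe using (Maybe; just; nothing)
open import Data.Product using (_×_; _,_; ∃; proj₁; proj₂)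
open import Data.Sum using (_⊎_; inj₁; inj₂)
open import Data.Unit using (⊤; tt)
import Data.Vec as Vec
open import Data.Vec using (Vec; []; _∷_; _∷ʳ_; initLast; lookup; updateAt)
open import Data.Vec.Properties using (∷-injective; ∷ʳ-injective)
open import Data.Vec.Relation.Unary.All as VAll using ([]; _∷_) renaming (All to VAll)
import Data.Vec.Relation.Unary.All.Properties as VAllP
open import Function using (_∘_; const; id)
open import Level using (0ℓ)
open import Relation.Binary.Bundles using (Setoid)
open import Relation.Binary.Definitions using (tri<; tri≈; tri>)
open import Relation.Binary.PropositionalEquality hiding ([_])
import Relation.Binary.Reasoning.Setoid
open import Relation.Nullary using (yes; no; ¬_)

-- The group is given only by a presentation, so comparing `K` with half of it requires a list of
-- its elements that is both complete and free of repetitions. Completeness comes from rewriting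
-- words to a normal form, one parabolic subgroup at a time; distinctness comes from the action on
-- signed arrangements. The normal form is chosen so that it also serves the signed sum: it records
-- where each value is inserted, and the sign of the permutation is read off from these positions.
-- The sign in the definition of `K` is that of the unsigned permutation. In type B generator 0
-- changes neither this sign nor the order of the values, so every vertex of `K` has its neighbour
-- along generator 0 in `K`; in type D generator 0 moves the same two positions as generator 1 and
-- may flip the same bit. Hence one direction is not controlled by the sensitivity of `g`, and the
-- bound has the summand 1.

-- A relation replaces the usual injective map because group elements are words up to a congruence:
-- two entries of `xs` need only be unable to share a partner.
pigeonhole : {A B : Set} (T : A → B → Set) {xs : List A} {ys : List B} →
  AllPairs (λ a a' → ∀ b → T a b → T a' b → ⊥) xs →
  All (λ a → ∃ λ b → b ∈ ys × T a b) xs → length xs ≤ length ys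
pigeonhole T [] [] = z≤n
pigeonhole T {x ∷ xs} (x# ∷ ps) ((b , b∈ , Txb) ∷ hs) with ∈-∃++ b∈
... | us , vs , refl = subst (suc (length xs) ≤_) (sym eq)
        (s≤s (pigeonhole T ps (All.zipWith avoid (x# , hs))))
  where
  eq : length (us ++ b ∷ vs) ≡ suc (length (us ++ vs))
  eq = trans (length-++ us) (trans (+-suc _ _) (cong suc (sym (length-++ us))))
  avoid : ∀ {a} → (∀ b → T x b → T a b → ⊥) × (∃ λ b' → b' ∈ us ++ b ∷ vs × T a b') →
          ∃ λ b' → b' ∈ us ++ vs × T a b'
  avoid (a# , b' , b'∈ , Tab') with ∈-++⁻ us b'∈
  ... | inj₁ q = b' , ∈-++⁺ˡ q , Tab'
  ... | inj₂ (here refl) = ⊥-elim (a# b' Txb Tab')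
  ... | inj₂ (there q) = b' , ∈-++⁺ʳ us q , Tab'

-- Boolean functions of low sensitivity with nonzero alternating sum

sign : Bool → ℤ
sign false = 1ℤ
sign true = -1ℤ

altSum : ∀ m → (Vec Bool m → ℤ) → ℤ
altSum zero G = G []
altSum (suc m) G = altSum m (λ v → G (false ∷ v)) ℤ.- altSum m (λ v → G (true ∷ v))

altSum-const : ∀ m c → altSum (suc m) (const c) ≡ 0ℤ
altSum-const m c = ℤP.+-inverseʳ (altSum m (const c))

drop : ∀ k {t} → Vec Bool (k + t) → Vec Bool t
drop zero v = v
drop (suc k) (_ ∷ v) = drop k v

altSum-drop : ∀ k {t} (G : Vec Bool t → ℤ) → altSum (suc k + t) (λ v → G (drop (suc k) v)) ≡ 0ℤ
altSum-drop k {t} G = ℤP.+-inverseʳ (altSum (k + t) (λ v → G (drop k v)))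

-- The conjunction of the first `k` bits, or else `h` of the remaining ones, evaluated by scanning
-- for the first false bit.
andOr : ∀ k {t} → (Vec Bool t → Bool) → Vec Bool (k + t) → Bool
andOr zero h v = true
andOr (suc k) h (true ∷ v) = andOr k h v
andOr (suc k) h (false ∷ v) = h (drop k v)

-- A list ks stands for consecutive blocks of sizes k + 1.
total : List ℕ → ℕ
total [] = 0
total (k ∷ ks) = suc k + total ks

blockOr : ∀ ks → Vec Bool (total ks) → Bool
blockOr [] _ = false
blockOr (k ∷ ks) = andOr (suc k) (blockOr ks)

0-i≢0 : ∀ {i} → i ≢ 0ℤ → 0ℤ ℤ.- i ≢ 0ℤ
0-i≢0 {i} i≢0 e = i≢0 (trans (sym (ℤP.neg-involutive i)) (cong ℤ.-_ (trans (sym (ℤP.+-identityˡ (ℤ.- i))) e)))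

-- If the first of several block bits is false, the value no longer depends on the next block bit,
-- so that half of the sum cancels. Only the half where the bit is true remains, up to sign, until
-- one block bit is left.
altSum-andOr : ∀ k {t} (h : Vec Bool t → Bool) →
  altSum t (λ v → sign (h v)) ℤ.- altSum t (const (sign true)) ≢ 0ℤ →
  altSum (suc k + t) (λ v → sign (andOr (suc k) h v)) ≢ 0ℤ
altSum-andOr zero h ne = ne
altSum-andOr (suc k) {t} h ne e = 0-i≢0 (altSum-andOr k h ne)
  (trans (cong (ℤ._- altSum (suc k + t) (λ v → sign (andOr (suc k) h v)))
               (sym (altSum-drop k (λ v → sign (h v))))) e)

blockOr-bias : ∀ k ks → altSum (total (k ∷ ks)) (λ v → sign (blockOr (k ∷ ks) v)) ≢ 0ℤ
-- With no block left `blockOr []` is false, and the difference is 1 - (-1) = 2.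
blockOr-bias k [] = altSum-andOr k {0} (blockOr []) λ ()
-- The remaining cube has positive dimension, so the constant function has alternating sum 0 and
-- only the bias of the other blocks matters.
blockOr-bias k (k' ∷ ks) = altSum-andOr k (blockOr (k' ∷ ks))
  λ e → blockOr-bias k' ks (trans (sym (ℤP.+-identityʳ _))
    (trans (cong (λ z → altSum (total (k' ∷ ks)) (λ v → sign (blockOr (k' ∷ ks) v)) ℤ.+ ℤ.- z)
             (sym (altSum-const (k' + total ks) (sign true)))) e))

-- The length of such a list bounds the sensitivity of `h` at `v`, without any counting of sensitive
-- coordinates.
Covers : ∀ {m} → (Vec Bool m → Bool) → Vec Bool m → List (Fin m) → Set
Covers h v S = ∀ j → h (updateAt v j not) ≢ h v → j ∈ S

shift : ∀ k {t} → List (Fin t) → List (Fin (k + t))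
shift zero S = S
shift (suc k) S = map suc (shift k S)

length-shift : ∀ k {t} (S : List (Fin t)) → length (shift k S) ≡ length S
length-shift zero S = refl
length-shift (suc k) S = trans (length-map suc (shift k S)) (length-shift k S)

block : ∀ k {t} → List (Fin (k + t))
block zero = []
block (suc k) = zero ∷ map suc (block k)

length-block : ∀ k {t} → length (block k {t}) ≡ k
length-block zero = refl
length-block (suc k) {t} = cong suc (trans (length-map suc (block k {t})) (length-block k))

drop-shift : ∀ k {t} (h : Vec Bool t → Bool) v {S} → Covers h (drop k v) S →
  Covers (λ w → h (drop k w)) v (shift k S)
drop-shift zero h v c j ne = c j ne
drop-shift (suc k) h (x ∷ v) c zero ne = ⊥-elim (ne refl)
drop-shift (suc k) h (x ∷ v) c (suc j) ne = ∈-map⁺ suc (drop-shift k h v c j ne)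

andOr-true : ∀ k {t} (h : Vec Bool t → Bool) v → h (drop k v) ≡ true → andOr k h v ≡ true
andOr-true zero h v e = refl
andOr-true (suc k) h (true ∷ v) e = andOr-true k h v e
andOr-true (suc k) h (false ∷ v) e = e

andOr-false : ∀ k {t} (h : Vec Bool t → Bool) v → andOr k h v ≡ false → h (drop k v) ≡ false
andOr-false k h v e with h (drop k v) in eq
... | false = refl
... | true = trans (sym (andOr-true k h v eq)) e

covers-later : ∀ k {t} (h : Vec Bool t → Bool) v {S} → h (drop k v) ≡ true →
  Covers h (drop k v) S → Covers (andOr k h) v (shift k S)
covers-later k h v e c j ne = drop-shift k h v c j
  λ e' → ne (trans (andOr-true k h _ (trans e' e)) (sym (andOr-true k h v e)))

covers-block : ∀ k {t} (h : Vec Bool t → Bool) v → h (drop k v) ≡ false → andOr k h v ≡ true →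
  Covers (andOr k h) v (block k)
covers-block zero h v _ _ j ne = ⊥-elim (ne refl)
covers-block (suc k) h (true ∷ v) e₁ e₂ zero ne = here refl
covers-block (suc k) h (true ∷ v) e₁ e₂ (suc j) ne = there (∈-map⁺ suc (covers-block k h v e₁ e₂ j ne))
covers-block (suc k) h (false ∷ v) e₁ e₂ j ne with trans (sym e₁) e₂
... | ()

-- Within the block only the first false bit can be sensitive: flipping any other block bit leaves a
-- false bit in the block, and `h` is still false.
covers-false : ∀ k {t} (h : Vec Bool t → Bool) v {S} → Covers h (drop k v) S → andOr k h v ≡ false →
  ∃ λ S' → length S' ≤ suc (length S) × Covers (andOr k h) v S'
covers-false (suc k) h (true ∷ v) {S} c e with covers-false k h v c e
... | S' , le , c' = map suc S' , subst (_≤ suc (length S)) (sym (length-map suc S')) le ,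
      λ { zero ne → ⊥-elim (ne (trans (andOr-false k h v e) (sym e))) ; (suc j) ne → ∈-map⁺ suc (c' j ne) }
covers-false (suc k) h (false ∷ v) {S} c e = zero ∷ map suc (shift k S) ,
  s≤s (≤-reflexive (trans (length-map suc (shift k S)) (length-shift k S))) ,
  λ { zero ne → here refl ; (suc j) ne → there (∈-map⁺ suc (drop-shift k h v c j ne)) }

-- At a zero every block contributes at most one coordinate; at a one only a single satisfied block matters.
blockOr-sensitivity₀ : ∀ ks v → blockOr ks v ≡ false →
  ∃ λ S → length S ≤ length ks × Covers (blockOr ks) v S
blockOr-sensitivity₀ [] v e = [] , z≤n , λ j ne → ⊥-elim (ne refl)
blockOr-sensitivity₀ (k ∷ ks) v e
  with blockOr-sensitivity₀ ks (drop (suc k) v) (andOr-false (suc k) (blockOr ks) v e)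
... | S , le , c with covers-false (suc k) (blockOr ks) v c e
... | S' , le' , c' = S' , ≤-trans le' (s≤s le) , c'

blockOr-sensitivity₁ : ∀ r ks v → All (_< r) ks → blockOr ks v ≡ true →
  ∃ λ S → length S ≤ r × Covers (blockOr ks) v S
blockOr-sensitivity₁ r (k ∷ ks) v (k< ∷ ks<) e with blockOr ks (drop (suc k) v) in eq
... | false = block (suc k) , ≤-trans (≤-reflexive (length-block (suc k) {total ks})) k< ,
              covers-block (suc k) (blockOr ks) v eq e
... | true with blockOr-sensitivity₁ r ks (drop (suc k) v) ks< eq
... | S , le , c = shift (suc k) S , ≤-trans (≤-reflexive (length-shift (suc k) S)) le ,
                   covers-later (suc k) (blockOr ks) v eq c

blockOr-sensitivity : ∀ r ks v → length ks ≤ r → All (_< r) ks →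
  ∃ λ S → length S ≤ r × Covers (blockOr ks) v S
blockOr-sensitivity r ks v len sz with blockOr ks v in eq
... | true with blockOr-sensitivity₁ r ks v sz eq
...   | S , le , c = S , le , λ j ne → c j (ne ∘ λ e → trans e eq)
blockOr-sensitivity r ks v len sz | false with blockOr-sensitivity₀ ks v eq
...   | S , le , c = S , ≤-trans le len , λ j ne → c j (ne ∘ λ e → trans e eq)

-- Full blocks of size `r` are cut off greedily. The entries are strictly below `r` because an entry
-- `k` stands for a block of size `k + 1`.
chunks : ∀ a r m → m ≤ a * r → ∃ λ ks → total ks ≡ m × length ks ≤ a × All (_< r) ks
chunks a r zero _ = [] , refl , z≤n , []
chunks (suc a) r (suc m) h with suc m ≤? r
... | yes m<r = m ∷ [] , cong suc (+-identityʳ m) , s≤s z≤n , m<r ∷ []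
chunks (suc a) zero (suc m) h | no _ with ≤-trans h (≤-reflexive (*-zeroʳ a))
... | ()
chunks (suc a) (suc r) (suc m) h | no m≮r
  with chunks a (suc r) (m ∸ r) (m≤n+o⇒m∸n≤o m r (s≤s⁻¹ h))
... | ks , e , l , s = r ∷ ks , cong suc (trans (cong (r +_) e) (m+[n∸m]≡n (≤-trans (n≤1+n r) (s≤s⁻¹ (≰⇒> m≮r))))) ,
      s≤s l , ≤-refl ∷ s

-- The function of Chung, Füredi, Graham and Seymour.
lowSensitivity : ∀ r m → suc m ≤ r * r → ∃ λ (g : Vec Bool (suc m) → Bool) →
  altSum (suc m) (λ v → sign (g v)) ≢ 0ℤ ×
  (∀ v → ∃ λ S → length S ≤ r × Covers g v S)
lowSensitivity r m h with chunks r r (suc m) h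
... | k ∷ ks , refl , l , s = blockOr (k ∷ ks) , blockOr-bias k ks , λ v → blockOr-sensitivity r (k ∷ ks) v l s

-- Order of pairs of values under adjacent transpositions and insertions

swap : ∀ {A : Set} {n} → ℕ → Vec A n → Vec A n
swap zero (a ∷ b ∷ l) = b ∷ a ∷ l
swap zero (a ∷ []) = a ∷ []
swap zero [] = []
swap (suc i) (a ∷ l) = a ∷ swap i l
swap (suc i) [] = []

before : ∀ {n} → ℕ → ℕ → Vec ℕ n → Bool
before u v [] = false
before u v (x ∷ l) with x ≟ u | x ≟ v
... | yes _ | _ = true
... | no _ | yes _ = false
... | no _ | no _ = before u v l

before-skip : ∀ {u v x} → x ≢ u × x ≢ v → ∀ {n} (l : Vec ℕ n) → before u v (x ∷ l) ≡ before u v l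
before-skip {u} {v} {x} (x≢u , x≢v) l with x ≟ u | x ≟ v
... | yes e | _ = ⊥-elim (x≢u e)
... | no _ | yes e = ⊥-elim (x≢v e)
... | no _ | no _ = refl

before-skip₂ : ∀ {u v x} → x ≢ u × x ≢ v → ∀ {n} y (l : Vec ℕ n) →
  before u v (y ∷ x ∷ l) ≡ before u v (y ∷ l)
before-skip₂ {u} {v} x∉ y l with y ≟ u | y ≟ v
... | yes _ | _ = refl
... | no _ | yes _ = refl
... | no _ | no _ = before-skip x∉ l

in-pair? : ∀ x u v → (x ≢ u × x ≢ v) ⊎ (x ≡ u ⊎ x ≡ v)
in-pair? x u v with x ≟ u | x ≟ v
... | yes e | _ = inj₂ (inj₁ e)
... | no _ | yes e = inj₂ (inj₂ e)
... | no d | no e = inj₁ (d , e)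

before-head : ∀ {u v x} → x ≡ u ⊎ x ≡ v → ∀ {n} (k l : Vec ℕ n) → before u v (x ∷ k) ≡ before u v (x ∷ l)
before-head {u} {v} {x} x∈ k l with x ≟ u | x ≟ v
... | yes _ | _ = refl
... | no _ | yes _ = refl
before-head (inj₁ e) k l | no ne | no _ = ⊥-elim (ne e)
before-head (inj₂ e) k l | no _ | no ne = ⊥-elim (ne e)

-- The order is decided by whichever of the two values occurs first. A swap that leaves this
-- occurrence and everything before it in place cannot change the order, so the reversing swap must
-- start exactly there.
before-swap-flip-unique : ∀ u v {n} (l : Vec ℕ n) i j →
  before u v (swap i l) ≢ before u v l → before u v (swap j l) ≢ before u v l → i ≡ j
before-swap-flip-unique u v l zero zero _ _ = refl
before-swap-flip-unique u v [] zero (suc j) p q = ⊥-elim (p refl)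
before-swap-flip-unique u v (x ∷ []) zero (suc j) p q = ⊥-elim (p refl)
before-swap-flip-unique u v [] (suc i) _ p q = ⊥-elim (p refl)
before-swap-flip-unique u v (x ∷ []) (suc i) zero p q = ⊥-elim (q refl)
before-swap-flip-unique u v (x ∷ y ∷ l) zero (suc j) p q with in-pair? x u v
... | inj₁ x∉ = ⊥-elim (p (trans (before-skip₂ x∉ y l) (sym (before-skip x∉ (y ∷ l)))))
... | inj₂ x∈ = ⊥-elim (q (before-head x∈ _ _))
before-swap-flip-unique u v (x ∷ y ∷ l) (suc i) zero p q =
  sym (before-swap-flip-unique u v (x ∷ y ∷ l) zero (suc i) q p)
before-swap-flip-unique u v (x ∷ l) (suc i) (suc j) p q with x ≟ u | x ≟ v
... | yes _ | _ = ⊥-elim (q refl)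
... | no _ | yes _ = ⊥-elim (q refl)
... | no _ | no _ = cong suc (before-swap-flip-unique u v l i j p q)

Apart : (u v u' v' : ℕ) → Set
Apart u v u' v' = ∀ x → x ≡ u' ⊎ x ≡ v' → x ≢ u × x ≢ v

-- An adjacent transposition that reverses a pair moves exactly this pair.
before-swap-stable : ∀ {u v u' v'} → Apart u v u' v' → ∀ {n} (l : Vec ℕ n) i →
  before u v (swap i l) ≢ before u v l → before u' v' (swap i l) ≡ before u' v' l
before-swap-stable _ [] zero p = refl
before-swap-stable _ (x ∷ []) zero p = refl
before-swap-stable _ [] (suc i) p = refl
before-swap-stable {u} {v} {u'} {v'} ap (x ∷ l) (suc i) p with x ≟ u | x ≟ v
... | yes _ | _ = ⊥-elim (p refl)
... | no _ | yes _ = ⊥-elim (p refl)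
... | no _ | no _ with x ≟ u' | x ≟ v'
...   | yes _ | _ = refl
...   | no _ | yes _ = refl
...   | no _ | no _ = before-swap-stable ap l i p
before-swap-stable {u} {v} {u'} {v'} ap (x ∷ y ∷ l) zero p with in-pair? x u' v' | in-pair? y u' v'
... | inj₁ x∉ | _ = trans (before-skip₂ x∉ y l) (sym (before-skip x∉ (y ∷ l)))
... | inj₂ _ | inj₁ y∉ = trans (before-skip y∉ (x ∷ l)) (sym (before-skip₂ y∉ x l))
... | inj₂ x∈ | inj₂ y∈ = ⊥-elim (p (trans (before-skip₂ (ap x x∈) y l) (sym (before-skip (ap x x∈) (y ∷ l)))))

insert : ∀ {A : Set} {n} → ℕ → A → Vec A n → Vec A (suc n)
insert zero a l = a ∷ l
insert (suc p) a [] = a ∷ []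
insert (suc p) a (b ∷ l) = b ∷ insert p a l

before-insert : ∀ {u v x} → x ≢ u × x ≢ v → ∀ {n} p (l : Vec ℕ n) → before u v (insert p x l) ≡ before u v l
before-insert x∉ zero l = before-skip x∉ l
before-insert x∉ (suc p) [] = before-skip x∉ []
before-insert {u} {v} x∉ (suc p) (y ∷ l) with y ≟ u | y ≟ v
... | yes _ | _ = refl
... | no _ | yes _ = refl
... | no _ | no _ = before-insert x∉ p l

≤ᵇ-suc : ∀ q p → (suc q ≤ᵇ suc p) ≡ (q ≤ᵇ p)
≤ᵇ-suc zero p = refl
≤ᵇ-suc (suc q) p = refl

-- The value `u` is inserted last, so at `q = p` it pushes `v` to the right; hence the comparison is
-- not strict.
before-insert₂ : ∀ {u v} → u ≢ v → ∀ q p {n} (l : Vec ℕ n) → VAll (λ x → x ≢ u × x ≢ v) l → p ≤ n →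
  before u v (insert q u (insert p v l)) ≡ (q ≤ᵇ p)
before-insert₂ {u} {v} u≢v zero p l l# p≤n with u ≟ u
... | yes _ = refl
... | no u≢u = ⊥-elim (u≢u refl)
before-insert₂ {u} {v} u≢v (suc q) zero l l# p≤n with v ≟ u | v ≟ v
... | yes e | _ = ⊥-elim (u≢v (sym e))
... | no _ | yes _ = refl
... | no _ | no v≢v = ⊥-elim (v≢v refl)
before-insert₂ u≢v (suc q) (suc p) (y ∷ l) (y# ∷ l#) (s≤s p≤n) =
  trans (before-skip y# (insert q _ (insert p _ l)))
    (trans (before-insert₂ u≢v q p l l# p≤n) (sym (≤ᵇ-suc q p)))

insert-injective : ∀ {A : Set} (B : A → Set) {n} p q {a b} (k l : Vec A n) → p ≤ n → q ≤ n →
  B a → B b → VAll (¬_ ∘ B) k → VAll (¬_ ∘ B) l →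
  insert p a k ≡ insert q b l → p ≡ q × a ≡ b × k ≡ l
insert-injective B zero zero k l _ _ _ _ _ _ refl = refl , refl , refl
insert-injective B zero (suc q) k (y ∷ l) _ _ Ba _ _ (y# ∷ _) refl = ⊥-elim (y# Ba)
insert-injective B (suc p) zero (x ∷ k) l _ _ _ Bb (x# ∷ _) _ refl = ⊥-elim (x# Bb)
insert-injective B (suc p) (suc q) (x ∷ k) (y ∷ l) (s≤s p≤) (s≤s q≤) Ba Bb (_ ∷ k#) (_ ∷ l#) e
  with ∷-injective e
... | refl , e' with insert-injective B p q k l p≤ q≤ Ba Bb k# l# e'
... | refl , refl , refl = refl , refl , refl

-- The values n-1, n-2, n-3, ... are paired off from the top for n = level b m, where b ∈ {0, 1} is the parity of n.
level : ℕ → ℕ → ℕ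
level b zero = b
level b (suc m) = suc (suc (level b m))

module Bits (b : ℕ) where

  bits : ∀ m {n} → Vec ℕ n → Vec Bool m
  bits zero l = []
  bits (suc m) l = before (suc (level b m)) (level b m) l ∷ bits m l

  lower : ∀ {c} m → c ≥ level b m → ∀ j → j < m → c ≢ suc (level b j) × c ≢ level b j
  lower {c} (suc m) c≥ j (s≤s j≤m) =
    >⇒≢ (≤-trans (s≤s (s≤s (mono j≤m))) c≥) , >⇒≢ (≤-trans (s≤s (≤-trans (mono j≤m) (n≤1+n _))) c≥)
    where
    mono : ∀ {i j} → i ≤ j → level b i ≤ level b j
    mono {j = zero} z≤n = ≤-refl
    mono {j = suc j} z≤n = ≤-trans (mono {j = j} z≤n) (≤-trans (n≤1+n _) (n≤1+n _))
    mono (s≤s h) = s≤s (s≤s (mono h))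

  bits-insert : ∀ {c} m → c ≥ level b m → ∀ p {n} (l : Vec ℕ n) → bits m (insert p c l) ≡ bits m l
  bits-insert zero c≥ p l = refl
  bits-insert (suc m) c≥ p l = cong₂ _∷_ (before-insert (lower (suc m) c≥ m ≤-refl) p l)
    (bits-insert m (≤-trans (≤-trans (n≤1+n _) (n≤1+n _)) c≥) p l)

  -- The pairs compared by `bits m` lie below `level b m`, hence are disjoint from the pair `u`,
  -- `v`, and one adjacent transposition cannot reverse two disjoint pairs.
  bits-stable : ∀ m {u v n} → u ≥ level b m → v ≥ level b m → (l : Vec ℕ n) → ∀ i →
    before u v (swap i l) ≢ before u v l → bits m (swap i l) ≡ bits m l
  bits-stable zero u≥ v≥ l i p = refl
  bits-stable (suc m) {u} {v} u≥ v≥ l i p = cong₂ _∷_ (before-swap-stable apart l i p)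
    (bits-stable m (≤-trans (≤-trans (n≤1+n _) (n≤1+n _)) u≥) (≤-trans (≤-trans (n≤1+n _) (n≤1+n _)) v≥) l i p)
    where
    apart : Apart u v (suc (level b m)) (level b m)
    apart x (inj₁ refl) = ≢-sym (proj₁ (lower (suc m) u≥ m ≤-refl)) , ≢-sym (proj₁ (lower (suc m) v≥ m ≤-refl))
    apart x (inj₂ refl) = ≢-sym (proj₂ (lower (suc m) u≥ m ≤-refl)) , ≢-sym (proj₂ (lower (suc m) v≥ m ≤-refl))

  Flips : ∀ m {n} → Vec ℕ n → ℕ → Fin m → Set
  Flips m l i j = lookup (bits m (swap i l)) j ≢ lookup (bits m l) j

  Flips-unique : ∀ m {n} (l : Vec ℕ n) i i' j → Flips m l i j → Flips m l i' j → i ≡ i'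
  Flips-unique (suc m) l i i' zero p q = before-swap-flip-unique _ _ l i i' p q
  Flips-unique (suc m) l i i' (suc j) p q = Flips-unique m l i i' j p q

  bits-swap : ∀ m {n} (l : Vec ℕ n) i → bits m (swap i l) ≢ bits m l →
    ∃ λ j → bits m (swap i l) ≡ updateAt (bits m l) j not × Flips m l i j
  bits-swap zero l i ne = ⊥-elim (ne refl)
  bits-swap (suc m) l i ne
    with before (suc (level b m)) (level b m) (swap i l) Bool.≟ before (suc (level b m)) (level b m) l
  ... | no p = zero , cong₂ _∷_ (¬-not p) (bits-stable m (n≤1+n _) ≤-refl l i p) , p
  ... | yes e with bits-swap m l i (λ e' → ne (cong₂ _∷_ e e'))
  ...   | j , e' , fl = suc j , cong₂ _∷_ e e' , fl

-- Finite integer sums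

Σ[_] : {A : Set} → List A → (A → ℤ) → ℤ
Σ[ [] ] f = 0ℤ
Σ[ x ∷ xs ] f = f x ℤ.+ Σ[ xs ] f

module _ {A : Set} where

  Σ-cong : ∀ (xs : List A) {f g} → (∀ {x} → x ∈ xs → f x ≡ g x) → Σ[ xs ] f ≡ Σ[ xs ] g
  Σ-cong [] e = refl
  Σ-cong (x ∷ xs) e = cong₂ ℤ._+_ (e (here refl)) (Σ-cong xs (e ∘ there))

  Σ-++ : ∀ (xs ys : List A) f → Σ[ xs ++ ys ] f ≡ Σ[ xs ] f ℤ.+ Σ[ ys ] f
  Σ-++ [] ys f = sym (ℤP.+-identityˡ _)
  Σ-++ (x ∷ xs) ys f = trans (cong (λ z → f x ℤ.+ z) (Σ-++ xs ys f)) (sym (ℤP.+-assoc (f x) _ _))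

  Σ-*ˡ : ∀ c (xs : List A) f → Σ[ xs ] (λ x → c ℤ.* f x) ≡ c ℤ.* Σ[ xs ] f
  Σ-*ˡ c [] f = sym (ℤP.*-zeroʳ c)
  Σ-*ˡ c (x ∷ xs) f = trans (cong (λ z → c ℤ.* f x ℤ.+ z) (Σ-*ˡ c xs f)) (sym (ℤP.*-distribˡ-+ c (f x) _))

  Σ-const : ∀ (xs : List A) c → Σ[ xs ] (const c) ≡ ℤ.+ length xs ℤ.* c
  Σ-const [] c = sym (ℤP.*-zeroˡ c)
  Σ-const (x ∷ xs) c = trans (cong (λ z → c ℤ.+ z) (Σ-const xs c)) (sym (ℤP.suc-* (ℤ.+ length xs) c))

  Σ-map : ∀ {B : Set} (h : B → A) ys f → Σ[ map h ys ] f ≡ Σ[ ys ] (f ∘ h)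
  Σ-map h [] f = refl
  Σ-map h (y ∷ ys) f = cong (λ z → f (h y) ℤ.+ z) (Σ-map h ys f)

  Σ-cartesianProductWith : ∀ {B C : Set} (h : B → C → A) xs ys f →
    Σ[ cartesianProductWith h xs ys ] f ≡ Σ[ xs ] (λ x → Σ[ ys ] (λ y → f (h x y)))
  Σ-cartesianProductWith h [] ys f = refl
  Σ-cartesianProductWith h (x ∷ xs) ys f = trans (Σ-++ (map (h x) ys) _ f)
    (cong₂ ℤ._+_ (Σ-map (h x) ys f) (Σ-cartesianProductWith h xs ys f))

-- Signed sums over insertion positions

parity : ℕ → Bool
parity zero = false
parity (suc n) = not (parity n)

bit : Bool → ℤ
bit false = 0ℤ
bit true = 1ℤ

sumBelow : ℕ → (ℕ → ℤ) → ℤ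
sumBelow zero f = 0ℤ
sumBelow (suc n) f = f 0 ℤ.+ sumBelow n (f ∘ suc)

Σ-upTo : ∀ n f → Σ[ upTo n ] f ≡ sumBelow n f
Σ-upTo n f = go n id
  where
  go : ∀ n g → Σ[ applyUpTo g n ] f ≡ sumBelow n (f ∘ g)
  go zero g = refl
  go (suc n) g = cong (λ z → f (g 0) ℤ.+ z) (go n (g ∘ suc))

sumBelow-cong : ∀ n {f g} → (∀ i → f i ≡ g i) → sumBelow n f ≡ sumBelow n g
sumBelow-cong zero e = refl
sumBelow-cong (suc n) e = cong₂ ℤ._+_ (e 0) (sumBelow-cong n (e ∘ suc))

-- M ∸ suc p is the number of adjacent transpositions that move an entry from the last of M positions to position p.
sgnMove : ℕ → ℕ → ℤ
sgnMove M p = sign (parity (M ∸ suc p))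

sign+bit : ∀ b → sign b ℤ.+ bit b ≡ bit (not b)
sign+bit false = refl
sign+bit true = refl

-- The signs alternate and end with +1, so over the last `k` positions they sum to 1 for odd `k` and
-- to 0 for even `k`. The positions from `q` on add `B - A` to the constant `A`.
insertionSum : ∀ M q A B → sumBelow M (λ p → sgnMove M p ℤ.* (if q ≤ᵇ p then B else A)) ≡
  A ℤ.* bit (parity M) ℤ.+ (B ℤ.- A) ℤ.* bit (parity (M ∸ q))
insertionSum zero zero A B = lemma A B
  where
  lemma : ∀ A B → 0ℤ ≡ A ℤ.* 0ℤ ℤ.+ (B ℤ.- A) ℤ.* 0ℤ
  lemma = solve-∀
insertionSum zero (suc q) A B = insertionSum zero zero A B
insertionSum (suc M) zero A B =
  trans (cong (λ z → sign (parity M) ℤ.* B ℤ.+ z) (insertionSum M zero A B))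
    (trans (lemma A B (sign (parity M)) (bit (parity M)))
      (cong (λ z → A ℤ.* z ℤ.+ (B ℤ.- A) ℤ.* z) (sign+bit (parity M))))
  where
  lemma : ∀ A B s o → s ℤ.* B ℤ.+ (A ℤ.* o ℤ.+ (B ℤ.- A) ℤ.* o) ≡ A ℤ.* (s ℤ.+ o) ℤ.+ (B ℤ.- A) ℤ.* (s ℤ.+ o)
  lemma = solve-∀
insertionSum (suc M) (suc q) A B =
  trans (cong (λ z → sign (parity M) ℤ.* A ℤ.+ z)
      (trans (sumBelow-cong M (λ p → cong (λ t → sgnMove M p ℤ.* (if t then B else A)) (≤ᵇ-suc q p)))
        (insertionSum M q A B)))
    (trans (lemma A (sign (parity M)) (bit (parity M)) ((B ℤ.- A) ℤ.* bit (parity (M ∸ q))))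
      (cong (λ z → A ℤ.* z ℤ.+ (B ℤ.- A) ℤ.* bit (parity (M ∸ q))) (sign+bit (parity M))))
  where
  lemma : ∀ A s o r → s ℤ.* A ℤ.+ (A ℤ.* o ℤ.+ r) ≡ A ℤ.* (s ℤ.+ o) ℤ.+ r
  lemma = solve-∀

countOdd : ℕ → ℤ
countOdd zero = 0ℤ
countOdd (suc M) = bit (parity (suc M)) ℤ.+ countOdd M

countOdd-pos : ∀ M → 0ℤ ℤ.< countOdd (suc M)
countOdd-pos zero = ℤ.+<+ (s≤s z≤n)
countOdd-pos (suc M) = ℤP.+-mono-≤-< (bit≥0 (parity (suc (suc M)))) (countOdd-pos M)
  where
  bit≥0 : ∀ b → 0ℤ ℤ.≤ bit b
  bit≥0 false = ℤ.+≤+ z≤n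
  bit≥0 true = ℤ.+≤+ z≤n

-- The sign at `q` is -1 exactly when `M ∸ q` is odd, so the contributions of `D` all have the same
-- sign and accumulate instead of cancelling.
signedBitSum : ∀ M A D → sumBelow (suc M) (λ q → sgnMove (suc M) q ℤ.* (A ℤ.+ D ℤ.* bit (parity (M ∸ q)))) ≡
  A ℤ.* bit (parity (suc M)) ℤ.- D ℤ.* countOdd M
signedBitSum zero A D = lemma A D
  where
  lemma : ∀ A D → 1ℤ ℤ.* (A ℤ.+ D ℤ.* 0ℤ) ℤ.+ 0ℤ ≡ A ℤ.* 1ℤ ℤ.- D ℤ.* 0ℤ
  lemma = solve-∀
signedBitSum (suc M) A D = trans
  (cong (λ z → sign (parity (suc M)) ℤ.* (A ℤ.+ D ℤ.* bit (parity (suc M))) ℤ.+ z) (signedBitSum M A D))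
  (step (parity (suc M)) (countOdd M))
  where
  lemma₀ : ∀ A D c → 1ℤ ℤ.* (A ℤ.+ D ℤ.* 0ℤ) ℤ.+ (A ℤ.* 0ℤ ℤ.- D ℤ.* c) ≡ A ℤ.* 1ℤ ℤ.- D ℤ.* (0ℤ ℤ.+ c)
  lemma₀ = solve-∀
  lemma₁ : ∀ A D c → -1ℤ ℤ.* (A ℤ.+ D ℤ.* 1ℤ) ℤ.+ (A ℤ.* 1ℤ ℤ.- D ℤ.* c) ≡ A ℤ.* 0ℤ ℤ.- D ℤ.* (1ℤ ℤ.+ c)
  lemma₁ = solve-∀
  step : ∀ b c → sign b ℤ.* (A ℤ.+ D ℤ.* bit b) ℤ.+ (A ℤ.* bit b ℤ.- D ℤ.* c) ≡
    A ℤ.* bit (not b) ℤ.- D ℤ.* (bit b ℤ.+ c)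
  step false c = lemma₀ A D c
  step true c = lemma₁ A D c

-- The part that ignores the order carries both `bit (parity M)` and `bit (parity (suc M))`, one of
-- which is 0. Only the difference between the two orders survives.
doubleInsertionSum : ∀ M A B →
  sumBelow (suc M) (λ q → sgnMove (suc M) q ℤ.* sumBelow M (λ p → sgnMove M p ℤ.* (if q ≤ᵇ p then B else A))) ≡
  countOdd M ℤ.* (A ℤ.- B)
doubleInsertionSum M A B = trans
  (sumBelow-cong (suc M) (λ q → cong (λ z → sgnMove (suc M) q ℤ.* z) (insertionSum M q A B)))
  (trans (signedBitSum M (A ℤ.* bit (parity M)) (B ℤ.- A)) (finish (parity M) (countOdd M)))
  where
  lemma₀ : ∀ A B c → A ℤ.* 0ℤ ℤ.* 1ℤ ℤ.- (B ℤ.- A) ℤ.* c ≡ c ℤ.* (A ℤ.- B)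
  lemma₀ = solve-∀
  lemma₁ : ∀ A B c → A ℤ.* 1ℤ ℤ.* 0ℤ ℤ.- (B ℤ.- A) ℤ.* c ≡ c ℤ.* (A ℤ.- B)
  lemma₁ = solve-∀
  finish : ∀ b c → A ℤ.* bit b ℤ.* bit (not b) ℤ.- (B ℤ.- A) ℤ.* c ≡ c ℤ.* (A ℤ.- B)
  finish false c = lemma₀ A B c
  finish true c = lemma₁ A B c

-- Codes of signed arrangements and their signed sum

-- A code lists, from the largest value down, the sign of a value and the position at which it is inserted
-- into the arrangement of the smaller values.
Code : ℕ → Set
Code = Vec (Bool × ℕ)

arrangement : ∀ {n} → Code n → Vec ℕ n
arrangement [] = []
arrangement {suc n} ((σ , p) ∷ x) = insert p n (arrangement x)

codeParity : ∀ {n} → Code n → Bool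
codeParity [] = false
codeParity {suc n} ((σ , p) ∷ x) = parity (n ∸ p) xor codeParity x

insert-All : ∀ {A : Set} {P : A → Set} {n} p {a} {l : Vec A n} → P a → VAll P l → VAll P (insert p a l)
insert-All zero Pa Pl = Pa ∷ Pl
insert-All (suc p) Pa [] = Pa ∷ []
insert-All (suc p) Pa (Pb ∷ Pl) = Pb ∷ insert-All p Pa Pl

arrangement-< : ∀ {n} (x : Code n) → VAll (_< n) (arrangement x)
arrangement-< [] = []
arrangement-< ((σ , p) ∷ x) = insert-All p ≤-refl (VAll.map m<n⇒m<1+n (arrangement-< x))

sign-xor : ∀ a b → sign (a xor b) ≡ sign a ℤ.* sign b
sign-xor false b = sym (ℤP.*-identityˡ (sign b))
sign-xor true false = refl
sign-xor true true = refl

-- The list `sgs n` holds the signs allowed for the value `n`. It is a parameter because type D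
-- leaves the value 0 no choice.
module Codes (sgs : ℕ → List Bool) where

  codes : ∀ n → List (Code n)
  codes zero = [] ∷ []
  codes (suc n) = cartesianProductWith _∷_ (cartesianProduct (sgs n) (upTo (suc n))) (codes n)

  Valid : ∀ {n} → Code n → Set
  Valid [] = ⊤
  Valid {suc n} ((σ , p) ∷ x) = (σ ∈ sgs n × p ≤ n) × Valid x

  codes-valid : ∀ {n} {x : Code n} → x ∈ codes n → Valid x
  codes-valid {zero} {[]} _ = tt
  codes-valid {suc n} x∈ with ∈-cartesianProductWith⁻ _∷_ (cartesianProduct (sgs n) (upTo (suc n))) (codes n) x∈
  ... | (σ , p) , x , c∈ , x∈' , refl with ∈-cartesianProduct⁻ (sgs n) (upTo (suc n)) c∈
  ... | σ∈ , p∈ = (σ∈ , s≤s⁻¹ (∈-upTo⁻ p∈)) , codes-valid x∈'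

  valid-codes : ∀ {n} {x : Code n} → Valid x → x ∈ codes n
  valid-codes {zero} {[]} _ = here refl
  valid-codes {suc n} {(σ , p) ∷ x} ((σ∈ , p≤) , v) =
    ∈-cartesianProductWith⁺ _∷_ (∈-cartesianProduct⁺ σ∈ (∈-upTo⁺ (s≤s p≤))) (valid-codes v)

  codes-unique : (∀ n → Unique (sgs n)) → ∀ n → Unique (codes n)
  codes-unique u zero = [] ∷ []
  codes-unique u (suc n) = UniqueP.cartesianProductWith⁺ _∷_ ∷-injective
    (UniqueP.cartesianProduct⁺ (u n) (UniqueP.upTo⁺ (suc n))) (codes-unique u n)

  Σ-codes : ∀ n f → Σ[ codes (suc n) ] f ≡
    Σ[ sgs n ] (λ σ → Σ[ upTo (suc n) ] λ p → Σ[ codes n ] λ x → f ((σ , p) ∷ x))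
  Σ-codes n f = trans (Σ-cartesianProductWith _∷_ (cartesianProduct (sgs n) (upTo (suc n))) (codes n) f)
    (Σ-cartesianProductWith _,_ (sgs n) (upTo (suc n)) (λ c → Σ[ codes n ] λ x → f (c ∷ x)))

  module _ (sgs-nonempty : ∀ n → 0 < length (sgs n)) (b : ℕ) (b≤1 : b ≤ 1) where

    open Bits b

    signedTerm : ∀ m → (Vec Bool m → ℤ) → Code (level b m) → ℤ
    signedTerm m G x = sign (codeParity x) ℤ.* G (bits m (arrangement x))

    -- The two largest values determine the top bit by comparing their positions and are invisible
    -- to the lower bits, which compare smaller values only.
    pairTerm : ∀ m G σ₂ σ₁ q p {x} → p ≤ level b m →
      signedTerm (suc m) G ((σ₂ , q) ∷ (σ₁ , p) ∷ x) ≡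
      (sgnMove (suc (suc (level b m))) q ℤ.* sgnMove (suc (level b m)) p) ℤ.*
        signedTerm m (λ v → if q ≤ᵇ p then G (true ∷ v) else G (false ∷ v)) x
    pairTerm m G σ₂ σ₁ q p {x} p≤ = trans
      (cong₂ ℤ._*_ (trans (sign-xor (parity (suc n ∸ q)) _) (cong (λ z → sign (parity (suc n ∸ q)) ℤ.* z) (sign-xor (parity (n ∸ p)) _)))
        (trans (cong₂ (λ t v → G (t ∷ v)) top low) (if-fun (q ≤ᵇ p))))
      (lemma (sign (parity (suc n ∸ q))) (sign (parity (n ∸ p))) _ _)
      where
      n = level b m
      l = arrangement x
      top : before (suc n) n (insert q (suc n) (insert p n l)) ≡ (q ≤ᵇ p)
      top = before-insert₂ 1+n≢n q p l
        (VAll.map (λ x<n → <⇒≢ (m<n⇒m<1+n x<n) , <⇒≢ x<n) (arrangement-< x)) p≤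
      low : bits m (insert q (suc n) (insert p n l)) ≡ bits m l
      low = trans (bits-insert m (n≤1+n _) q (insert p n l)) (bits-insert m ≤-refl p l)
      if-fun : ∀ t {v} → G (t ∷ v) ≡ (if t then G (true ∷ v) else G (false ∷ v))
      if-fun false = refl
      if-fun true = refl
      lemma : ∀ a b c d → (a ℤ.* (b ℤ.* c)) ℤ.* d ≡ (a ℤ.* b) ℤ.* (c ℤ.* d)
      lemma = solve-∀

    -- The signs of the two largest values occur nowhere in the term, so they contribute only their
    -- number; the positions contribute through `doubleInsertionSum`.
    signedSum-step : ∀ m G → Σ[ codes (level b (suc m)) ] (signedTerm (suc m) G) ≡
      (ℤ.+ length (sgs (suc (level b m))) ℤ.* ℤ.+ length (sgs (level b m)) ℤ.* countOdd (suc (level b m))) ℤ.*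
        (Σ[ codes (level b m) ] (signedTerm m (λ v → G (false ∷ v))) ℤ.-
         Σ[ codes (level b m) ] (signedTerm m (λ v → G (true ∷ v))))
    signedSum-step m G = begin
      Σ[ codes (suc (suc n)) ] (signedTerm (suc m) G)
        ≡⟨ Σ-codes (suc n) _ ⟩
      Σ[ sgs (suc n) ] (λ σ₂ → Σ[ upTo (suc (suc n)) ] λ q → Σ[ codes (suc n) ] λ y → signedTerm (suc m) G ((σ₂ , q) ∷ y))
        ≡⟨ Σ-cong (sgs (suc n)) (λ {σ₂} _ → Σ-cong (upTo (suc (suc n))) (λ {q} _ → inner σ₂ q)) ⟩
      Σ[ sgs (suc n) ] (λ _ → Σ[ upTo (suc (suc n)) ] λ q → s q ℤ.* (L₁ ℤ.* r q))
        ≡⟨ Σ-const (sgs (suc n)) _ ⟩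
      L₂ ℤ.* Σ[ upTo (suc (suc n)) ] (λ q → s q ℤ.* (L₁ ℤ.* r q))
        ≡⟨ cong (λ z → L₂ ℤ.* z) (trans (Σ-cong (upTo (suc (suc n))) (λ {q} _ → rot (s q) L₁ (r q)))
             (Σ-*ˡ L₁ (upTo (suc (suc n))) _)) ⟩
      L₂ ℤ.* (L₁ ℤ.* Σ[ upTo (suc (suc n)) ] (λ q → s q ℤ.* r q))
        ≡⟨ cong (λ z → L₂ ℤ.* (L₁ ℤ.* z)) (trans (Σ-upTo (suc (suc n)) (λ q → s q ℤ.* r q)) (doubleInsertionSum (suc n) A B)) ⟩
      L₂ ℤ.* (L₁ ℤ.* (countOdd (suc n) ℤ.* (A ℤ.- B)))
        ≡⟨ assoc L₂ L₁ (countOdd (suc n)) _ ⟩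
      (L₂ ℤ.* L₁ ℤ.* countOdd (suc n)) ℤ.* (A ℤ.- B) ∎
      where
      open ≡-Reasoning
      n = level b m
      L₁ = ℤ.+ length (sgs n)
      L₂ = ℤ.+ length (sgs (suc n))
      A = Σ[ codes n ] (signedTerm m (λ v → G (false ∷ v)))
      B = Σ[ codes n ] (signedTerm m (λ v → G (true ∷ v)))
      s = sgnMove (suc (suc n))
      r : ℕ → ℤ
      r q = sumBelow (suc n) (λ p → sgnMove (suc n) p ℤ.* (if q ≤ᵇ p then B else A))
      rot : ∀ a b c → a ℤ.* (b ℤ.* c) ≡ b ℤ.* (a ℤ.* c)
      rot = solve-∀
      assoc : ∀ a b c d → a ℤ.* (b ℤ.* (c ℤ.* d)) ≡ (a ℤ.* b ℤ.* c) ℤ.* d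
      assoc = solve-∀
      pull : ∀ t → Σ[ codes n ] (signedTerm m (λ v → if t then G (true ∷ v) else G (false ∷ v))) ≡ (if t then B else A)
      pull false = refl
      pull true = refl
      inner : ∀ σ₂ q → Σ[ codes (suc n) ] (λ y → signedTerm (suc m) G ((σ₂ , q) ∷ y)) ≡ s q ℤ.* (L₁ ℤ.* r q)
      inner σ₂ q = begin
        Σ[ codes (suc n) ] (λ y → signedTerm (suc m) G ((σ₂ , q) ∷ y))
          ≡⟨ Σ-codes n _ ⟩
        Σ[ sgs n ] (λ σ₁ → Σ[ upTo (suc n) ] λ p → Σ[ codes n ] λ x → signedTerm (suc m) G ((σ₂ , q) ∷ (σ₁ , p) ∷ x))
          ≡⟨ Σ-cong (sgs n) (λ {σ₁} _ → Σ-cong (upTo (suc n)) (λ {p} p∈ →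
               trans (Σ-cong (codes n) (λ {x} _ → pairTerm m G σ₂ σ₁ q p {x} (s≤s⁻¹ (∈-upTo⁻ p∈))))
                 (trans (Σ-*ˡ (s q ℤ.* sgnMove (suc n) p) (codes n) _)
                   (trans (ℤP.*-assoc (s q) _ _) (cong (λ z → s q ℤ.* (sgnMove (suc n) p ℤ.* z)) (pull (q ≤ᵇ p))))))) ⟩
        Σ[ sgs n ] (λ _ → Σ[ upTo (suc n) ] λ p → s q ℤ.* (sgnMove (suc n) p ℤ.* (if q ≤ᵇ p then B else A)))
          ≡⟨ Σ-const (sgs n) _ ⟩
        L₁ ℤ.* Σ[ upTo (suc n) ] (λ p → s q ℤ.* (sgnMove (suc n) p ℤ.* (if q ≤ᵇ p then B else A)))
          ≡⟨ cong (λ z → L₁ ℤ.* z) (trans (Σ-*ˡ (s q) (upTo (suc n)) _)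
               (cong (λ z → s q ℤ.* z) (Σ-upTo (suc n) (λ p → sgnMove (suc n) p ℤ.* (if q ≤ᵇ p then B else A))))) ⟩
        L₁ ℤ.* (s q ℤ.* r q)
          ≡⟨ rot L₁ (s q) (r q) ⟩
        s q ℤ.* (L₁ ℤ.* r q) ∎

    *-pos : ∀ {i j} → 0ℤ ℤ.< i → 0ℤ ℤ.< j → 0ℤ ℤ.< i ℤ.* j
    *-pos {i} {j} 0<i 0<j = subst (ℤ._< i ℤ.* j) (ℤP.*-zeroʳ i)
      (ℤP.*-monoˡ-<-pos i {{ℤ.positive 0<i}} 0<j)

    -- The constant precedes the quantifier over `G` because the induction applies the statement to
    -- both restrictions of `G` and needs the same factor for each.
    signedSum : ∀ m → ∃ λ C → 0ℤ ℤ.< C ×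
      (∀ G → Σ[ codes (level b m) ] (signedTerm m G) ≡ C ℤ.* altSum m G)
    signedSum zero = base b b≤1
      where
      base : ∀ b → b ≤ 1 → ∃ λ C → 0ℤ ℤ.< C ×
        (∀ G → Σ[ codes b ] (λ x → sign (codeParity x) ℤ.* G (Bits.bits b zero (arrangement x))) ≡ C ℤ.* G [])
      base zero _ = 1ℤ , ℤ.+<+ (s≤s z≤n) , λ G → ℤP.+-identityʳ _
      base (suc zero) _ = ℤ.+ length (sgs 0) , ℤ.+<+ (sgs-nonempty 0) , λ G →
        trans (Σ-codes 0 _) (trans (Σ-const (sgs 0) _) (cong (λ z → ℤ.+ length (sgs 0) ℤ.* z)
          (trans (ℤP.+-identityʳ _) (trans (ℤP.+-identityʳ _) (ℤP.*-identityˡ _)))))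
      base (suc (suc b)) (s≤s ())
    signedSum (suc m) with signedSum m
    ... | C , C>0 , e = k ℤ.* C ,
        *-pos (*-pos (*-pos (ℤ.+<+ (sgs-nonempty (suc n))) (ℤ.+<+ (sgs-nonempty n))) (countOdd-pos n)) C>0 ,
        λ G → trans (signedSum-step m G)
          (trans (cong₂ (λ u v → k ℤ.* (u ℤ.- v)) (e _) (e _)) (lemma k C _ _))
      where
      n = level b m
      k = ℤ.+ length (sgs (suc n)) ℤ.* ℤ.+ length (sgs n) ℤ.* countOdd (suc n)
      lemma : ∀ k C u v → k ℤ.* (C ℤ.* u ℤ.- C ℤ.* v) ≡ (k ℤ.* C) ℤ.* (u ℤ.- v)
      lemma = solve-∀

-- Compatibility of the word congruence with concatenation

module _ {n : ℕ} {M : Fin n → Fin n → ℕ} where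

  weq-∷ : ∀ i {u v} → WordEq M u v → WordEq M (i ∷ u) (i ∷ v)
  weq-∷ i weq-refl = weq-refl
  weq-∷ i (weq-sym e) = weq-sym (weq-∷ i e)
  weq-∷ i (weq-trans e f) = weq-trans (weq-∷ i e) (weq-∷ i f)
  weq-∷ i (weq-rel u v j k) = weq-rel (i ∷ u) v j k

  weq-++ˡ : ∀ w {u v} → WordEq M u v → WordEq M (w ++ u) (w ++ v)
  weq-++ˡ [] e = e
  weq-++ˡ (i ∷ w) e = weq-∷ i (weq-++ˡ w e)

  weq-++ʳ : ∀ w {u v} → WordEq M u v → WordEq M (u ++ w) (v ++ w)
  weq-++ʳ w weq-refl = weq-refl
  weq-++ʳ w (weq-sym e) = weq-sym (weq-++ʳ w e)
  weq-++ʳ w (weq-trans e f) = weq-trans (weq-++ʳ w e) (weq-++ʳ w f)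
  weq-++ʳ w (weq-rel u v i j) = subst₂ (WordEq M)
    (sym (trans (++-assoc u _ w) (cong (u ++_) (++-assoc (alt i j (2 * M i j)) v w))))
    (sym (++-assoc u v w)) (weq-rel u (v ++ w) i j)

-- The bound deduced from a signed enumeration of the group

Holds : {A : Set} → (A → Bool) → List A → List A
Holds f = filter (λ x → f x Bool.≟ true)

Σ-sign : {A : Set} (f : A → Bool) (xs : List A) →
  Σ[ xs ] (sign ∘ f) ≡ ℤ.+ length xs ℤ.- (ℤ.+ length (Holds f xs) ℤ.+ ℤ.+ length (Holds f xs))
Σ-sign f [] = refl
Σ-sign f (x ∷ xs) with f x
... | false = trans (cong (λ z → 1ℤ ℤ.+ z) (Σ-sign f xs)) (lemma (ℤ.+ length xs) (ℤ.+ length (Holds f xs)))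
  where
  lemma : ∀ a k → 1ℤ ℤ.+ (a ℤ.- (k ℤ.+ k)) ≡ (1ℤ ℤ.+ a) ℤ.- (k ℤ.+ k)
  lemma = solve-∀
... | true = trans (cong (λ z → -1ℤ ℤ.+ z) (Σ-sign f xs)) (lemma (ℤ.+ length xs) (ℤ.+ length (Holds f xs)))
  where
  lemma : ∀ a k → -1ℤ ℤ.+ (a ℤ.- (k ℤ.+ k)) ≡ (1ℤ ℤ.+ a) ℤ.- ((1ℤ ℤ.+ k) ℤ.+ (1ℤ ℤ.+ k))
  lemma = solve-∀

majority : {A : Set} (f : A → Bool) (xs : List A) → Σ[ xs ] (sign ∘ f) ℤ.< 0ℤ →
  length xs < length (Holds f xs) + length (Holds f xs)
majority f xs neg = ℤP.drop‿+<+ (subst₂ ℤ._<_ (lemma (ℤ.+ length xs) k) (ℤP.+-identityˡ k)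
  (ℤP.+-monoˡ-< k (subst (ℤ._< 0ℤ) (Σ-sign f xs) neg)))
  where
  k = ℤ.+ length (Holds f xs) ℤ.+ ℤ.+ length (Holds f xs)
  lemma : ∀ a k → (a ℤ.- k) ℤ.+ k ≡ a
  lemma = solve-∀

-- These are the only facts about the group that the counting uses: `χ` will be the sign of the
-- unsigned permutation and `ρ` its arrangement. Their behaviour is prescribed for the generators
-- other than 0 only, which lets types B and D share the argument.
module Deduction {N : ℕ} (M : Fin N → Fin N → ℕ) (b m' : ℕ)
  (elements : List (Word N))
  (elements-distinct : Distinct M elements)
  (elements-complete : ∀ w → ∃ λ e → e ∈ elements × WordEq M w e)
  (χ : Word N → Bool) (χ-resp : ∀ {u v} → WordEq M u v → χ u ≡ χ v)
  (ρ : Word N → Vec ℕ N) (ρ-resp : ∀ {u v} → WordEq M u v → ρ u ≡ ρ v)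
  (χ-snoc : ∀ w i {k} → toℕ i ≡ suc k → χ (w ++ [ i ]) ≡ not (χ w))
  (ρ-snoc : ∀ w i {k} → toℕ i ≡ suc k → ρ (w ++ [ i ]) ≡ swap k (ρ w))
  (M-diag : ∀ i → M i i ≡ 1)
  (i₁ : Fin N) (toℕ-i₁ : toℕ i₁ ≡ 1)
  (signedSum : ∃ λ C → 0ℤ ℤ.< C ×
    (∀ G → Σ[ elements ] (λ e → sign (χ e) ℤ.* G (Bits.bits b (suc m') (ρ e))) ≡ C ℤ.* altSum (suc m') G))
  (cube : HasHypercube M (suc m'))
  where

  open Bits b

  m = suc m'

  snoc-involutive : ∀ w i → WordEq M ((w ++ [ i ]) ++ [ i ]) w
  snoc-involutive w i = subst₂ (WordEq M) (sym (++-assoc w [ i ] [ i ])) (++-identityʳ w)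
    (subst (λ k → WordEq M (w ++ (alt i i (2 * k) ++ [])) (w ++ [])) (M-diag i) (weq-rel w [] i i))

  flip₁ : Word N → Word N
  flip₁ w = w ++ [ i₁ ]

  independent-bound : ∀ I → Independent M I → length I + length I ≤ length elements
  independent-bound I (distinct , nonadjacent) =
    subst (_≤ length elements) (trans (length-++ I) (cong (length I +_) (length-map flip₁ I)))
      (pigeonhole (WordEq M)
        (AllPairsP.++⁺ (AllPairs.map (λ a≠a' e p q → a≠a' (weq-trans p (weq-sym q))) distinct)
          (AllPairsP.map⁺ (AllPairs.map (λ {a} {a'} a≠a' e p q → a≠a'
            (weq-trans (weq-sym (snoc-involutive a i₁))
              (weq-trans (weq-++ʳ [ i₁ ] (weq-trans p (weq-sym q))) (snoc-involutive a' i₁)))) distinct))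
          (cross nonadjacent))
        (All.universal (λ a → let e , e∈ , eq = elements-complete a in e , e∈ , eq) (I ++ map flip₁ I)))
    where
    Separated : Word N → Word N → Set
    Separated a c = ∀ e → WordEq M a e → WordEq M c e → ⊥
    -- The value of `χ` changes along `i₁`, so `a` and its translate are different group elements.
    self : ∀ a → Separated a (flip₁ a)
    self a e p q = not-¬ {χ a} refl (trans (χ-resp (weq-trans p (weq-sym q))) (χ-snoc a i₁ toℕ-i₁))
    cross : ∀ {J} → AllPairs (λ a c → ¬ Adj M a c) J → All (λ a → All (Separated a) (map flip₁ J)) J
    cross [] = []
    cross {a ∷ J} (a# ∷ ps) =
      -- Nonadjacency is known only in the order of the list; as `i₁` is an involution, this
      -- excludes coincidences in both directions.
      (self a ∷ AllP.map⁺ (All.map (λ {c} a≁c e p q → a≁c (i₁ ,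
        weq-trans (weq-sym (snoc-involutive c i₁)) (weq-++ʳ [ i₁ ] (weq-trans q (weq-sym p))))) a#)) ∷
      All.zipWith (λ { {c} (a≁c , cs) → (λ e p q → a≁c (i₁ , weq-trans p (weq-sym q))) ∷ cs }) (a# , cross ps)

  module _ (g : Vec Bool m → Bool) (r : ℕ)
    (g-sensitivity : ∀ v → ∃ λ S → length S ≤ r × Covers g v S) (ε : Bool) where

    inK : Word N → Bool
    inK w = ε xor (χ w xor g (bits m (ρ w)))

    inK-resp : ∀ {u v} → WordEq M u v → inK u ≡ inK v
    inK-resp e = cong₂ (λ s l → ε xor (s xor g (bits m l))) (χ-resp e) (ρ-resp e)

    -- These are the pigeonholes for neighbours: one per bit, and `nothing` for generator 0. The
    -- latter accounts for the summand 1 in the degree bound.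
    Direction : ℕ → Vec ℕ N → Maybe (Fin m) → Set
    Direction zero l d = d ≡ nothing
    Direction (suc k) l d = ∃ λ j → d ≡ just j × Flips m l k j

    Direction-unique : ∀ i i' l d → Direction i l d → Direction i' l d → i ≡ i'
    Direction-unique zero zero l _ _ _ = refl
    Direction-unique zero (suc i') l _ refl (_ , () , _)
    Direction-unique (suc i) zero l _ (_ , () , _) refl
    Direction-unique (suc i) (suc i') l _ (j , refl , p) (j , refl , q) = cong suc (Flips-unique m l i i' j p q)

    -- Since `χ` flips along such a generator, membership of both ends in `K` forces `g` to flip as
    -- well.
    g-changes : ∀ x i {k} → toℕ i ≡ suc k → inK x ≡ true → inK (x ++ [ i ]) ≡ true →
      g (bits m (swap k (ρ x))) ≢ g (bits m (ρ x))
    g-changes x i eq p q g≡ = clash ε (χ x) (g (bits m (ρ x)))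
      (trans p (trans (sym q) (cong₂ (λ s t → ε xor (s xor t)) (χ-snoc x i eq)
        (trans (cong (g ∘ bits m) (ρ-snoc x i eq)) g≡))))
      where
      clash : ∀ e s t → e xor (s xor t) ≡ e xor (not s xor t) → ⊥
      clash false false false ()
      clash false false true ()
      clash false true false ()
      clash false true true ()
      clash true false false ()
      clash true false true ()
      clash true true false ()
      clash true true true ()

    degree-bound : MaxDegLe M (Holds inK elements) (r + 1)
    degree-bound x x∈ L L⊆K adj with g-sensitivity (bits m (ρ x))
    ... | S , |S|≤r , covers = ≤-trans
      (pigeonhole T
        (AllPairs.map (λ y≠y' d p q → y≠y' (T-unique d p q))
          (AllPairs-resp-⊆ L⊆K (AllPairsP.filter⁺ _ elements-distinct)))
        (All.zipWith (λ { (a , q) → neighbour a q })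
          (adj , All-resp-⊆ L⊆K (AllP.all-filter _ elements))))
      (≤-trans (s≤s (≤-reflexive (length-map just S))) (≤-trans (s≤s |S|≤r) (≤-reflexive (+-comm 1 r))))
      where
      AllPairs-resp-⊆ : ∀ {A : Set} {R : A → A → Set} {xs ys} → xs ⊆ ys → AllPairs R ys → AllPairs R xs
      AllPairs-resp-⊆ Sub.[] [] = []
      AllPairs-resp-⊆ (y Sub.∷ʳ τ) (_ ∷ ps) = AllPairs-resp-⊆ τ ps
      AllPairs-resp-⊆ (refl Sub.∷ τ) (p ∷ ps) = All-resp-⊆ τ p ∷ AllPairs-resp-⊆ τ ps
      T : Word N → Maybe (Fin m) → Set
      T y d = ∃ λ i → WordEq M y (x ++ [ i ]) × Direction (toℕ i) (ρ x) d
      T-unique : ∀ {y y'} d → T y d → T y' d → WordEq M y y'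
      T-unique d (i , p , s) (i' , p' , s') with toℕ-injective (Direction-unique (toℕ i) (toℕ i') (ρ x) d s s')
      ... | refl = weq-trans p (weq-sym p')
      direction : ∀ i k → toℕ i ≡ k → inK (x ++ [ i ]) ≡ true →
        ∃ λ d → d ∈ nothing ∷ map just S × Direction k (ρ x) d
      direction i zero eq q = nothing , here refl , refl
      direction i (suc k) eq q with bits-swap m (ρ x) k (λ e → ne (cong g e))
        where ne = g-changes x i eq (proj₂ (∈-filter⁻ _ {xs = elements} x∈)) q
      ... | j , e , fl = just j , there (∈-map⁺ just (covers j (ne ∘ trans (cong g e)))) , j , refl , fl
        where ne = g-changes x i eq (proj₂ (∈-filter⁻ _ {xs = elements} x∈)) q
      neighbour : ∀ {y} → Adj M x y → inK y ≡ true → ∃ λ d → d ∈ nothing ∷ map just S × T y d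
      neighbour (i , e) q with direction i (toℕ i) refl (trans (sym (inK-resp e)) q)
      ... | d , d∈ , s = d , d∈ , i , e , s

    sigma-bound : Σ[ elements ] (sign ∘ inK) ℤ.< 0ℤ → SigmaLe M (r + 1)
    sigma-bound neg = Holds inK elements ,
      (AllPairsP.filter⁺ _ elements-distinct ,
       λ I ind → half (≤-<-trans (independent-bound I ind) (majority inK elements neg))) ,
      degree-bound
      where
      half : ∀ {a c} → a + a < c + c → a < c
      half {a} {c} h with a <? c
      ... | yes p = p
      ... | no p = ⊥-elim (<⇒≱ h (+-mono-≤ (≮⇒≥ p) (≮⇒≥ p)))

    Σ-inK : Σ[ elements ] (sign ∘ inK) ≡
      sign ε ℤ.* Σ[ elements ] (λ e → sign (χ e) ℤ.* sign (g (bits m (ρ e))))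
    Σ-inK = trans (Σ-cong elements (λ {e} _ → trans (sign-xor ε _) (cong (λ z → sign ε ℤ.* z) (sign-xor (χ e) _))))
      (Σ-*ˡ (sign ε) elements _)

  bound : Bound M
  bound d r (_ , maximal) (d≤r² , _) = by-sign signedSum (lowSensitivity r m' (≤-trans (maximal m cube) d≤r²))
    where
    by-sign : (∃ λ C → 0ℤ ℤ.< C × (∀ G → Σ[ elements ] (λ e → sign (χ e) ℤ.* G (bits m (ρ e))) ≡ C ℤ.* altSum m G)) →
      (∃ λ g → altSum m (λ v → sign (g v)) ≢ 0ℤ × (∀ v → ∃ λ S → length S ≤ r × Covers g v S)) → SigmaLe M (r + 1)
    -- A negative sum of signs means that `inK` holds for more than half of the elements; `ε`
    -- reverses the sum when it is positive.
    by-sign (C , C>0 , sum) (g , bias , sens) with ℤP.<-cmp (C ℤ.* altSum m (λ v → sign (g v))) 0ℤ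
    ... | tri< neg _ _ = sigma-bound g r sens false
          (subst (ℤ._< 0ℤ) (sym (trans (Σ-inK g r sens false) (trans (ℤP.*-identityˡ _) (sum (sign ∘ g))))) neg)
    ... | tri> _ _ pos = sigma-bound g r sens true
          (subst (ℤ._< 0ℤ) (sym (trans (Σ-inK g r sens true) (trans (ℤP.-1*i≡-i _) (cong ℤ.-_ (sum (sign ∘ g)))))) (ℤP.neg-mono-< pos))
    ... | tri≈ _ z _ with ℤP.i*j≡0⇒i≡0∨j≡0 C z
    ...   | inj₁ C≡0 = ⊥-elim (ℤP.<-irrefl (sym C≡0) C>0)
    ...   | inj₂ e = ⊥-elim (bias e)

-- Braid relations and descending runs of generators

mA-suc : ∀ i j → mA (suc i) (suc j) ≡ mA i j
mA-suc zero j = refl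
mA-suc (suc i) j = refl

mA-diag : ∀ i → mA i i ≡ 1
mA-diag zero = refl
mA-diag (suc i) = trans (mA-suc i i) (mA-diag i)

mA-next : ∀ i → mA i (suc i) ≡ 3
mA-next zero = refl
mA-next (suc i) = trans (mA-suc i (suc i)) (mA-next i)

mA-far : ∀ {i j} → suc (suc i) ≤ j → mA i j ≡ 2
mA-far {zero} (s≤s (s≤s _)) = refl
mA-far {suc i} {suc j} (s≤s h) = trans (mA-suc i j) (mA-far h)

alternating : ℕ → ℕ → ℕ → List ℕ
alternating i j zero = []
alternating i j (suc k) = i ∷ alternating j i k

-- Moves the entry at position p + d to position p.
down : ℕ → ℕ → List ℕ
down p zero = []
down p (suc d) = suc (p + d) ∷ down p d

down-snoc : ∀ p d w → down (suc p) d ++ suc p ∷ w ≡ down p (suc d) ++ w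
down-snoc p zero w = cong (λ i → suc i ∷ w) (sym (+-identityʳ p))
down-snoc p (suc d) w = cong₂ _∷_ (cong suc (sym (+-suc p d))) (down-snoc p d w)

down-letters : ∀ p d → All (λ i → ∃ λ j → i ≡ suc j × p ≤ j × j < p + d) (down p d)
down-letters p zero = []
down-letters p (suc d) = (p + d , refl , m≤m+n p d , ≤-reflexive (sym (+-suc p d))) ∷
  All.map (λ { (j , e , p≤j , j<) → j , e , p≤j , <-≤-trans j< (+-monoʳ-≤ p (n≤1+n d)) }) (down-letters p d)

-- Words over ℕ are compared in the group of rank N, where letters i ≥ N stand for the identity.
module Words (N : ℕ) (mat : ℕ → ℕ → ℕ) (mat-diag : ∀ i → mat i i ≡ 1)
  (mat-suc : ∀ i j → mat (suc i) (suc j) ≡ mA i j) where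

  M : Fin N → Fin N → ℕ
  M i j = mat (toℕ i) (toℕ j)

  letter : ℕ → Word N
  letter i with i <? N
  ... | yes i<N = [ fromℕ< i<N ]
  ... | no _ = []

  letter-< : ∀ {i} (i<N : i < N) → letter i ≡ [ fromℕ< i<N ]
  letter-< {i} i<N with i <? N
  ... | yes _ = refl
  ... | no i≮N = ⊥-elim (i≮N i<N)

  letter-≥ : ∀ {i} → ¬ i < N → letter i ≡ []
  letter-≥ {i} i≮N with i <? N
  ... | yes i<N = ⊥-elim (i≮N i<N)
  ... | no _ = refl

  embed : List ℕ → Word N
  embed = concatMap letter

  embed-++ : ∀ u v → embed (u ++ v) ≡ embed u ++ embed v
  embed-++ = concatMap-++ letter

  infix 4 _~_
  record _~_ (u v : List ℕ) : Set where
    constructor mk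
    field weq : WordEq M (embed u) (embed v)
  open _~_ public

  ~-refl : ∀ {u} → u ~ u
  ~-refl = mk weq-refl

  ~-sym : ∀ {u v} → u ~ v → v ~ u
  ~-sym (mk e) = mk (weq-sym e)

  ~-trans : ∀ {u v w} → u ~ v → v ~ w → u ~ w
  ~-trans (mk e) (mk f) = mk (weq-trans e f)

  ~-reflexive : ∀ {u v} → u ≡ v → u ~ v
  ~-reflexive refl = ~-refl

  ++ˡ : ∀ w {u v} → u ~ v → w ++ u ~ w ++ v
  ++ˡ w {u} {v} (mk e) = mk (subst₂ (WordEq M) (sym (embed-++ w u)) (sym (embed-++ w v)) (weq-++ˡ (embed w) e))

  ++ʳ : ∀ w {u v} → u ~ v → u ++ w ~ v ++ w
  ++ʳ w {u} {v} (mk e) = mk (subst₂ (WordEq M) (sym (embed-++ u w)) (sym (embed-++ v w)) (weq-++ʳ (embed w) e))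

  ∷ˡ : ∀ i {u v} → u ~ v → i ∷ u ~ i ∷ v
  ∷ˡ i = ++ˡ [ i ]

  ~-setoid : Setoid 0ℓ 0ℓ
  ~-setoid = record { Carrier = List ℕ ; _≈_ = _~_ ; isEquivalence = record { refl = ~-refl ; sym = ~-sym ; trans = ~-trans } }

  module ~-Reasoning = Relation.Binary.Reasoning.Setoid ~-setoid
  open ~-Reasoning

  relator : ∀ {i j k} → i < N → j < N → mat i j ≡ k → alternating i j (2 * k) ~ []
  relator {i} {j} {k} i<N j<N e = mk (subst₂ (WordEq M) (trans (++-identityʳ _) (sym (embed-alternating (2 * k) i<N j<N))) refl
    (subst (λ k → WordEq M (alt fi fj (2 * k) ++ []) []) e' (weq-rel [] [] fi fj)))
    where
    fi = fromℕ< i<N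
    fj = fromℕ< j<N
    e' : M fi fj ≡ k
    e' = trans (cong₂ mat (toℕ-fromℕ< i<N) (toℕ-fromℕ< j<N)) e
    embed-alternating : ∀ k {i j} (i<N : i < N) (j<N : j < N) →
      embed (alternating i j k) ≡ alt (fromℕ< i<N) (fromℕ< j<N) k
    embed-alternating zero _ _ = refl
    embed-alternating (suc k) i<N j<N = cong₂ _++_ (letter-< i<N) (embed-alternating k j<N i<N)

  square : ∀ i w → i ∷ i ∷ w ~ w
  square i w with i <? N
  ... | yes i<N = ++ʳ w (relator i<N i<N (mat-diag i))
  ... | no i≮N = mk (subst (λ x → WordEq M (x ++ (x ++ embed w)) (embed w)) (sym (letter-≥ i≮N)) weq-refl)

  ++-reverse : ∀ v w → v ++ reverse v ++ w ~ w
  ++-reverse [] w = ~-refl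
  ++-reverse (i ∷ v) w = begin
    i ∷ v ++ reverse (i ∷ v) ++ w     ≡⟨ cong (λ z → i ∷ v ++ z ++ w) (unfold-reverse i v) ⟩
    i ∷ v ++ (reverse v ++ [ i ]) ++ w ≡⟨ cong (λ z → i ∷ v ++ z) (++-assoc (reverse v) [ i ] w) ⟩
    i ∷ v ++ reverse v ++ i ∷ w       ≈⟨ ∷ˡ i (++-reverse v (i ∷ w)) ⟩
    i ∷ i ∷ w                         ≈⟨ square i w ⟩
    w ∎

  -- Letters are their own inverses, so `reverse v` inverts `v` and each relator can be read as an
  -- equation between its two parts.
  relator-split : ∀ u v → u ++ v ~ [] → ∀ w → u ++ w ~ reverse v ++ w
  relator-split u v e w = begin
    u ++ w                       ≈⟨ ++ˡ u (++-reverse v w) ⟨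
    u ++ v ++ reverse v ++ w     ≡⟨ ++-assoc u v _ ⟨
    (u ++ v) ++ reverse v ++ w   ≈⟨ ++ʳ (reverse v ++ w) e ⟩
    reverse v ++ w ∎

  Commute : ℕ → ℕ → Set
  Commute i j = ∀ w → i ∷ j ∷ w ~ j ∷ i ∷ w

  -- This holds for letters out of range too, since they are the identity. For `braid` the range
  -- matters: with one letter trivial, the relation would make the other trivial.
  commute : ∀ {i j} → mat i j ≡ 2 → Commute i j
  commute {i} {j} e w with i <? N | j <? N
  ... | yes i<N | yes j<N = relator-split (i ∷ j ∷ []) (i ∷ j ∷ []) (relator i<N j<N e) w
  ... | no i≮N | _ = mk (subst (λ x → WordEq M (x ++ (letter j ++ embed w)) (letter j ++ (x ++ embed w))) (sym (letter-≥ i≮N)) weq-refl)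
  ... | _ | no j≮N = mk (subst (λ x → WordEq M (letter i ++ (x ++ embed w)) (x ++ (letter i ++ embed w))) (sym (letter-≥ j≮N)) weq-refl)

  commute-sym : ∀ {i j} → Commute i j → Commute j i
  commute-sym c w = ~-sym (c w)

  commute-far : ∀ {i j} → suc (suc i) ≤ j → Commute (suc i) (suc j)
  commute-far {i} {j} h = commute (trans (mat-suc i j) (mA-far h))

  braid : ∀ {i} → suc (suc i) < N → ∀ w → suc i ∷ suc (suc i) ∷ suc i ∷ w ~ suc (suc i) ∷ suc i ∷ suc (suc i) ∷ w
  braid {i} h = relator-split (a ∷ b ∷ a ∷ []) (b ∷ a ∷ b ∷ [])
    (relator (<-trans ≤-refl h) h (trans (mat-suc i (suc i)) (mA-next i)))
    where
    a = suc i
    b = suc (suc i)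

  CommuteWord : List ℕ → ℕ → Set
  CommuteWord u i = ∀ w → u ++ i ∷ w ~ i ∷ u ++ w

  commuteWord : ∀ {i u} → All (λ j → Commute j i) u → CommuteWord u i
  commuteWord [] w = ~-refl
  commuteWord {i} {j ∷ u} (c ∷ cs) w = begin
    j ∷ u ++ i ∷ w  ≈⟨ ∷ˡ j (commuteWord cs w) ⟩
    j ∷ i ∷ u ++ w  ≈⟨ c (u ++ w) ⟩
    i ∷ j ∷ u ++ w ∎

  -- Two braid moves, one on each side of `u`, with the letter between them carried across `u`. This
  -- is how a twofold conjugate lets its inner conjugating letter through.
  conjugate-pass : ∀ {i u} → suc (suc i) < N → CommuteWord u (suc (suc i)) → ∀ w →
    suc (suc i) ∷ suc i ∷ u ++ suc i ∷ suc (suc i) ∷ suc i ∷ w ~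
    suc i ∷ suc (suc i) ∷ suc i ∷ u ++ suc i ∷ suc (suc i) ∷ w
  conjugate-pass {i} {u} h c w = begin
    b ∷ a ∷ u ++ a ∷ b ∷ a ∷ w  ≈⟨ ++ˡ (b ∷ a ∷ u) (braid h w) ⟩
    b ∷ a ∷ u ++ b ∷ a ∷ b ∷ w  ≈⟨ ++ˡ (b ∷ a ∷ []) (c (a ∷ b ∷ w)) ⟩
    b ∷ a ∷ b ∷ u ++ a ∷ b ∷ w  ≈⟨ braid h (u ++ a ∷ b ∷ w) ⟨
    a ∷ b ∷ a ∷ u ++ a ∷ b ∷ w ∎
    where
    a = suc i
    b = suc (suc i)

  -- The letter commutes with the `k` lowest letters of the run, loses one in index at a braid move,
  -- and then commutes with the `e` highest letters.
  down-pass-high : ∀ p k e → suc (suc (p + k)) < N → ∀ w →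
    down p (e + suc (suc k)) ++ suc (suc (p + k)) ∷ w ~ suc (p + k) ∷ down p (e + suc (suc k)) ++ w
  down-pass-high p k zero h w rewrite +-suc p k = begin
    b ∷ a ∷ down p k ++ b ∷ w  ≈⟨ ++ˡ (b ∷ a ∷ []) (commuteWord
      (All.map (λ { (j , refl , _ , j<) → commute-far (s≤s j<) }) (down-letters p k)) w) ⟩
    b ∷ a ∷ b ∷ down p k ++ w  ≈⟨ braid h (down p k ++ w) ⟨
    a ∷ b ∷ a ∷ down p k ++ w ∎
    where
    a = suc (p + k)
    b = suc a
  down-pass-high p k (suc e) h w = begin
    t ∷ down p (e + suc (suc k)) ++ suc (suc (p + k)) ∷ w  ≈⟨ ∷ˡ t (down-pass-high p k e h w) ⟩
    t ∷ suc (p + k) ∷ down p (e + suc (suc k)) ++ w        ≈⟨ commute-far far _ ⟨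
    suc (p + k) ∷ t ∷ down p (e + suc (suc k)) ++ w ∎
    where
    t = suc (p + (e + suc (suc k)))
    far : suc (suc (p + k)) ≤ p + (e + suc (suc k))
    far = ≤-trans (≤-reflexive (sym (trans (+-suc p (suc k)) (cong suc (+-suc p k))))) (+-monoʳ-≤ p (m≤n+m (suc (suc k)) e))

  -- A letter below `p` commutes with the run, the letter `p` lengthens it, the letter `p + 1`
  -- cancels its end, and a higher letter comes out in front with index lowered by one.
  down-step : ∀ p d i → p + d < N → suc i ≤ p + d →
    (∃ λ p' → ∃ λ d' → p' + d' ≡ p + d × (∀ w → down p d ++ suc i ∷ w ~ down p' d' ++ w)) ⊎
    (∃ λ i' → suc i' < p + d × (∀ w → down p d ++ suc i ∷ w ~ suc i' ∷ down p d ++ w))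
  down-step p d i n<N i<n with <-cmp (suc i) p
  ... | tri< i<p _ _ = inj₂ (i , <-≤-trans i<p (m≤m+n p d) , commuteWord
        (All.map (λ { (j , refl , p≤j , _) → commute-sym (commute-far (≤-trans i<p p≤j)) }) (down-letters p d)))
  ... | tri≈ _ refl _ = inj₁ (i , suc d , +-suc i d , λ w → ~-reflexive (down-snoc i d w))
  down-step p zero i n<N i<n | tri> _ _ p<i = ⊥-elim (<⇒≱ p<i (subst (suc i ≤_) (+-identityʳ p) i<n))
  down-step p (suc d) i n<N i<n | tri> _ _ (s≤s p≤i) with m≤n⇒m<n∨m≡n p≤i
  ... | inj₂ refl = inj₁ (suc p , d , sym (+-suc p d) , λ w → begin
          down p (suc d) ++ suc p ∷ w            ≡⟨ down-snoc p d (suc p ∷ w) ⟨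
          down (suc p) d ++ suc p ∷ suc p ∷ w    ≈⟨ ++ˡ (down (suc p) d) (square (suc p) w) ⟩
          down (suc p) d ++ w ∎)
  ... | inj₁ p<i with m≤n⇒∃[o]m+o≡n p<i
  ...   | k , refl with m≤n⇒∃[o]m+o≡n {suc k} {d} (+-cancelˡ-≤ p _ _
          (subst₂ _≤_ (sym (+-suc p k)) refl (s≤s⁻¹ (subst (suc (suc (p + k)) ≤_) (+-suc p d) i<n))))
  ...     | e , refl = inj₂ (p + k , i<n ,
            subst (λ x → ∀ w → down p x ++ suc (suc (p + k)) ∷ w ~ suc (p + k) ∷ down p x ++ w) (+-comm e (suc (suc k)))
              (down-pass-high p k e (≤-<-trans i<n n<N)))

-- Actions of words on arrangements, and weighted parity

foldActions : ∀ {A : Set} → (ℕ → A → A) → List ℕ → A → A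
foldActions act [] a = a
foldActions act (i ∷ u) a = foldActions act u (act i a)

foldActions-++ : ∀ {A : Set} (act : ℕ → A → A) u v a →
  foldActions act (u ++ v) a ≡ foldActions act v (foldActions act u a)
foldActions-++ act [] v a = refl
foldActions-++ act (i ∷ u) v a = foldActions-++ act u v (act i a)

swaps : ∀ {A : Set} {n} → List ℕ → Vec A n → Vec A n
swaps = foldActions swap

swaps-alternating-suc : ∀ {A : Set} k i j {n} (a : A) (l : Vec A n) →
  swaps (alternating (suc i) (suc j) k) (a ∷ l) ≡ a ∷ swaps (alternating i j k) l
swaps-alternating-suc zero i j a l = refl
swaps-alternating-suc (suc k) i j a l = swaps-alternating-suc k j i a (swap i l)

swap-involutive : ∀ {A : Set} i {n} (l : Vec A n) → swap i (swap i l) ≡ l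
swap-involutive zero [] = refl
swap-involutive zero (a ∷ []) = refl
swap-involutive zero (a ∷ b ∷ l) = refl
swap-involutive (suc i) [] = refl
swap-involutive (suc i) (a ∷ l) = cong (a ∷_) (swap-involutive i l)

swaps-relator : ∀ {A : Set} i j {n} (l : Vec A n) → suc i < n → suc j < n →
  swaps (alternating i j (2 * mA i j)) l ≡ l
swaps-relator zero zero (a ∷ b ∷ l) (s≤s (s≤s _)) _ = refl
swaps-relator zero (suc zero) (a ∷ b ∷ c ∷ l) _ (s≤s (s≤s (s≤s _))) = refl
swaps-relator zero (suc (suc j)) (a ∷ b ∷ l) (s≤s (s≤s _)) _ = cong (λ l → a ∷ b ∷ l) (swap-involutive j l)
swaps-relator (suc zero) zero (a ∷ b ∷ c ∷ l) (s≤s (s≤s (s≤s _))) _ = refl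
swaps-relator (suc (suc i)) zero (a ∷ b ∷ l) _ (s≤s (s≤s _)) = cong (λ l → a ∷ b ∷ l) (swap-involutive i l)
swaps-relator (suc i) (suc j) (a ∷ l) (s≤s hi) (s≤s hj) = trans
  (cong (λ k → swaps (alternating (suc i) (suc j) (2 * k)) (a ∷ l)) (mA-suc i j))
  (trans (swaps-alternating-suc (2 * mA i j) i j a l) (cong (a ∷_) (swaps-relator i j l hi hj)))

swap-∷ʳ : ∀ {A : Set} i {n} (l : Vec A n) a → suc i < n → swap i (l ∷ʳ a) ≡ swap i l ∷ʳ a
swap-∷ʳ zero (b ∷ c ∷ l) a (s≤s (s≤s _)) = refl
swap-∷ʳ (suc i) (b ∷ l) a (s≤s h) = cong (b ∷_) (swap-∷ʳ i l a h)

swap-last : ∀ {A : Set} {n} (l : Vec A n) a b → swap n (l ∷ʳ a ∷ʳ b) ≡ l ∷ʳ b ∷ʳ a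
swap-last [] a b = refl
swap-last (c ∷ l) a b = cong (c ∷_) (swap-last l a b)

swap-map : ∀ {A B : Set} (f : A → B) i {n} (l : Vec A n) → Vec.map f (swap i l) ≡ swap i (Vec.map f l)
swap-map f zero [] = refl
swap-map f zero (a ∷ []) = refl
swap-map f zero (a ∷ b ∷ l) = refl
swap-map f (suc i) [] = refl
swap-map f (suc i) (a ∷ l) = cong (f a ∷_) (swap-map f i l)

insert-map : ∀ {A B : Set} (f : A → B) p a {n} (l : Vec A n) → Vec.map f (insert p a l) ≡ insert p (f a) (Vec.map f l)
insert-map f zero a l = refl
insert-map f (suc p) a [] = refl
insert-map f (suc p) a (b ∷ l) = cong (f b ∷_) (insert-map f p a l)

SignedValue : Set
SignedValue = Bool × ℕ

negate : SignedValue → SignedValue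
negate (σ , k) = not σ , k

weightParity : Bool → List ℕ → Bool
weightParity w₀ [] = false
weightParity w₀ (zero ∷ u) = w₀ xor weightParity w₀ u
weightParity w₀ (suc i ∷ u) = not (weightParity w₀ u)

weightParity-++ : ∀ w₀ u v → weightParity w₀ (u ++ v) ≡ weightParity w₀ u xor weightParity w₀ v
weightParity-++ w₀ [] v = refl
weightParity-++ w₀ (zero ∷ u) v = trans (cong (w₀ xor_) (weightParity-++ w₀ u v)) (sym (xor-assoc w₀ _ _))
weightParity-++ w₀ (suc i ∷ u) v = trans (cong not (weightParity-++ w₀ u v)) (not-distribˡ-xor (weightParity w₀ u) _)

parity-double : ∀ k → parity (2 * k) ≡ false
parity-double zero = refl
parity-double (suc k) = trans (cong (not ∘ parity) (+-suc k (k + 0))) (trans (not-involutive _) (parity-double k))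

weightParity-alternating : ∀ w₀ i j k → weightParity w₀ (alternating (suc i) (suc j) k) ≡ parity k
weightParity-alternating w₀ i j zero = refl
weightParity-alternating w₀ i j (suc k) = cong not (weightParity-alternating w₀ j i k)

weightParity-down : ∀ w₀ p d → weightParity w₀ (down p d) ≡ parity d
weightParity-down w₀ p zero = refl
weightParity-down w₀ p (suc d) = cong not (weightParity-down w₀ p d)

identityArrangement : ∀ n → Vec SignedValue n
identityArrangement zero = []
identityArrangement (suc n) = identityArrangement n ∷ʳ (false , n)

-- i is a generator of the parabolic subgroup of rank n; there is a generator 0 only from rank k₀ + 1 on.
Generator : ℕ → ℕ → ℕ → Set
Generator k₀ n zero = k₀ < n
Generator k₀ n (suc i) = suc i < n

generatorAct : ∀ {A : Set} {n} → (Vec A n → Vec A n) → ℕ → Vec A n → Vec A n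
generatorAct f zero = f
generatorAct f (suc i) = swap i

-- The field `correction` is the side effect on the other entries when the sign of the last entry is
-- changed: none in type B, negation of the head in type D, where signs change in pairs.
record Action (k₀ : ℕ) (base : List ℕ) : Set where
  field
    zeroAct : ∀ {n} → Vec SignedValue n → Vec SignedValue n
    correction : ∀ {n} → Vec SignedValue n → Vec SignedValue n

  act : ∀ {n} → ℕ → Vec SignedValue n → Vec SignedValue n
  act = generatorAct zeroAct

  acts : ∀ {n} → List ℕ → Vec SignedValue n → Vec SignedValue n
  acts = foldActions act

  field
    zeroAct-∷ʳ : ∀ {n} (l : Vec SignedValue n) a → k₀ < n → zeroAct (l ∷ʳ a) ≡ zeroAct l ∷ʳ a
    correction-∷ʳ : ∀ {n} (l : Vec SignedValue n) a → k₀ ≤ n → correction (l ∷ʳ a) ≡ correction l ∷ʳ a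
    correction-involutive : ∀ {n} (l : Vec SignedValue n) → correction (correction l) ≡ l
    correction-values : ∀ {n} (l : Vec SignedValue n) → Vec.map proj₂ (correction l) ≡ Vec.map proj₂ l
    base-acts : ∀ (l : Vec SignedValue k₀) a → acts base (l ∷ʳ a) ≡ correction l ∷ʳ negate a

module Signs (k₀ : ℕ) where

  -- Below `k₀` there is no choice of sign. In type D this concerns the value 0, whose sign is
  -- determined by the others.
  signs : ℕ → List Bool
  signs n with k₀ ≤? n
  ... | yes _ = false ∷ true ∷ []
  ... | no _ = false ∷ []

  signs-all : ∀ {n} → k₀ ≤ n → ∀ σ → σ ∈ signs n
  signs-all {n} h σ with k₀ ≤? n
  signs-all h false | yes _ = here refl
  signs-all h true | yes _ = there (here refl)
  ... | no h' = ⊥-elim (h' h)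

  signs-true : ∀ {n} → true ∈ signs n → k₀ ≤ n
  signs-true {n} t∈ with k₀ ≤? n
  ... | yes h = h
  signs-true (here ()) | no _
  signs-true (there ()) | no _

  signs-false : ∀ n → false ∈ signs n
  signs-false n with k₀ ≤? n
  ... | yes _ = here refl
  ... | no _ = here refl

  signs-unique : ∀ n → Unique (signs n)
  signs-unique n with k₀ ≤? n
  ... | yes _ = ((λ ()) ∷ []) ∷ [] ∷ []
  ... | no _ = [] ∷ []

  signs-nonempty : ∀ n → 0 < length (signs n)
  signs-nonempty n with k₀ ≤? n
  ... | yes _ = s≤s z≤n
  ... | no _ = s≤s z≤n

-- Normal forms and enumeration of the group

-- Types B (k₀ = 0) and D (k₀ = 1) at once.  base changes the sign of the value k₀ (and, in type D, of the head as well),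
-- and θ describes conjugation by conj e, which is trivial in type B and the diagram automorphism in type D.
module Group (N : ℕ) (mat : ℕ → ℕ → ℕ) (mat-diag : ∀ i → mat i i ≡ 1)
  (mat-suc : ∀ i j → mat (suc i) (suc j) ≡ mA i j) where

  open Words N mat mat-diag mat-suc

  module Tower (k₀ : ℕ) (k₀≤1 : k₀ ≤ 1) (base : List ℕ) (θ : ℕ → ℕ)
    (mat₀-far : ∀ j → k₀ < j → mat 0 (suc j) ≡ 2)
    (base-letters : All (Generator k₀ (suc k₀)) base)
    (base-square : ∀ w → base ++ base ++ w ~ w)
    (base-zero : ∀ w → down 0 k₀ ++ 0 ∷ w ~ base ++ w)
    (base-pass : suc k₀ < N → ∀ i → Generator k₀ (suc k₀) i → ∀ w →
      suc k₀ ∷ base ++ suc k₀ ∷ i ∷ w ~ θ i ∷ suc k₀ ∷ base ++ suc k₀ ∷ w)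
    (θ-high : ∀ i → k₀ ≤ i → θ (suc i) ≡ suc i)
    (θ-generator : ∀ n i → Generator k₀ n i → Generator k₀ n (θ i))
    (A : Action k₀ base)
    (acts-relator : ∀ i j → i < N → j < N → (l : Vec SignedValue N) → Action.acts A (alternating i j (2 * mat i j)) l ≡ l)
    (w₀ : Bool)
    (weightParity-base : weightParity w₀ base ≡ false)
    (weightParity-relator : ∀ i j → weightParity w₀ (alternating i j (2 * mat i j)) ≡ false)
    where

    open Action A
    open Signs k₀
    open Codes signs

    Gen : ℕ → ℕ → Set
    Gen = Generator k₀

    Gen-mono : ∀ {m n} i → m ≤ n → Gen m i → Gen n i
    Gen-mono zero m≤n g = <-≤-trans g m≤n
    Gen-mono (suc i) m≤n g = <-≤-trans g m≤n

    Gen-< : ∀ {n} i → Gen n i → i < n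
    Gen-< zero g = ≤-<-trans z≤n g
    Gen-< (suc i) g = g

    commute-Gen : ∀ {n} i → Gen n i → Commute i (suc n)
    commute-Gen zero g = commute (mat₀-far _ g)
    commute-Gen (suc i) g = commute-far g

    -- The product changing the sign of the value k₀ + e (and, in type D, of the head).
    conj : ℕ → List ℕ
    conj zero = base
    conj (suc e) = suc (k₀ + e) ∷ conj e ++ [ suc (k₀ + e) ]

    conj-++ : ∀ e w → conj (suc e) ++ w ≡ suc (k₀ + e) ∷ conj e ++ suc (k₀ + e) ∷ w
    conj-++ e w = cong (suc (k₀ + e) ∷_) (++-assoc (conj e) _ w)

    conj-letters : ∀ e → All (Gen (suc (k₀ + e))) (conj e)
    conj-letters zero = subst (λ k → All (Gen (suc k)) base) (sym (+-identityʳ k₀)) base-letters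
    conj-letters (suc e) = s≤s last ∷ AllP.++⁺ (All.map (λ {i} → Gen-mono i (s≤s (+-monoʳ-≤ k₀ (n≤1+n e)))) (conj-letters e)) (s≤s last ∷ [])
      where
      last : suc (k₀ + e) ≤ k₀ + suc e
      last = ≤-reflexive (sym (+-suc k₀ e))

    module _ where

      open ~-Reasoning

      conj-square : ∀ e w → conj e ++ conj e ++ w ~ w
      conj-square zero w = base-square w
      conj-square (suc e) w = begin
        conj (suc e) ++ conj (suc e) ++ w                ≡⟨ trans (conj-++ e _) (cong (λ z → b ∷ conj e ++ b ∷ z) (conj-++ e w)) ⟩
        b ∷ conj e ++ b ∷ b ∷ conj e ++ b ∷ w            ≈⟨ ++ˡ (b ∷ conj e) (square b _) ⟩
        b ∷ conj e ++ conj e ++ b ∷ w                    ≈⟨ ∷ˡ b (conj-square e (b ∷ w)) ⟩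
        b ∷ b ∷ w                                        ≈⟨ square b w ⟩
        w ∎
        where b = suc (k₀ + e)

      Gen-split : ∀ {n} i → k₀ < n → Gen (suc n) i → Gen n i ⊎ i ≡ n
      Gen-split zero k₀<n g = inj₁ k₀<n
      Gen-split (suc i) k₀<n g = m≤n⇒m<n∨m≡n (s≤s⁻¹ g)

      ConjPass : ℕ → Set
      ConjPass e = ∀ i → k₀ + e < N → Gen (k₀ + e) i → ∀ w → conj e ++ i ∷ w ~ θ i ∷ conj e ++ w

      -- A generator of lower rank commutes with the outer letter and passes the inner conjugate by
      -- induction. The only new generator is the outer letter of that inner conjugate;
      -- `conjugate-pass` lets it through, and `θ` fixes it.
      conj-pass-suc : ∀ e → ConjPass (suc e) → ConjPass (suc (suc e))
      conj-pass-suc e ih i h g w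
        with Gen-split {k₀ + suc e} i (m<m+n k₀ (s≤s z≤n)) (subst (λ n → Gen n i) (+-suc k₀ (suc e)) g)
      ... | inj₁ g' = begin
        conj (suc (suc e)) ++ i ∷ w          ≡⟨ conj-++ (suc e) (i ∷ w) ⟩
        b ∷ conj (suc e) ++ b ∷ i ∷ w        ≈⟨ ++ˡ (b ∷ conj (suc e)) (commute-Gen i g' w) ⟨
        b ∷ conj (suc e) ++ i ∷ b ∷ w        ≈⟨ ∷ˡ b (ih i (<-trans (+-monoʳ-< k₀ ≤-refl) h) g' (b ∷ w)) ⟩
        b ∷ θ i ∷ conj (suc e) ++ b ∷ w      ≈⟨ commute-Gen (θ i) (θ-generator _ i g') _ ⟨
        θ i ∷ b ∷ conj (suc e) ++ b ∷ w      ≡⟨ cong (θ i ∷_) (conj-++ (suc e) w) ⟨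
        θ i ∷ conj (suc (suc e)) ++ w ∎
        where b = suc (k₀ + suc e)
      ... | inj₂ refl rewrite +-suc k₀ (suc e) | +-suc k₀ e | θ-high (k₀ + e) (m≤m+n k₀ e) = begin
        (b ∷ (a ∷ conj e ++ [ a ]) ++ [ b ]) ++ a ∷ w    ≡⟨ unfold (a ∷ w) ⟩
        b ∷ a ∷ conj e ++ a ∷ b ∷ a ∷ w                  ≈⟨ conjugate-pass h (commuteWord (All.map (λ {i} → commute-Gen i) (conj-letters e))) w ⟩
        a ∷ b ∷ a ∷ conj e ++ a ∷ b ∷ w                  ≡⟨ cong (a ∷_) (unfold w) ⟨
        a ∷ (b ∷ (a ∷ conj e ++ [ a ]) ++ [ b ]) ++ w ∎
        where
        a = suc (k₀ + e)
        b = suc a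
        unfold : ∀ w → (b ∷ (a ∷ conj e ++ [ a ]) ++ [ b ]) ++ w ≡ b ∷ a ∷ conj e ++ a ∷ b ∷ w
        unfold w = trans (cong (b ∷_) (++-assoc (a ∷ conj e ++ [ a ]) [ b ] w)) (cong (λ z → b ∷ a ∷ z) (++-assoc (conj e) [ a ] (b ∷ w)))

      conj-pass : ∀ e → ConjPass e
      -- As `k₀ ≤ 1`, there are no generators of rank `k₀`.
      conj-pass zero zero _ g w = ⊥-elim (<-irrefl refl (subst (k₀ <_) (+-identityʳ k₀) g))
      conj-pass zero (suc i) _ g w with ≤-trans (subst (suc (suc i) ≤_) (+-identityʳ k₀) g) k₀≤1
      ... | s≤s ()
      conj-pass (suc zero) i h g w rewrite +-identityʳ k₀ | +-comm k₀ 1 | ++-assoc base [ suc k₀ ] (i ∷ w) | ++-assoc base [ suc k₀ ] w =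
        base-pass h i g w
      conj-pass (suc (suc e)) = conj-pass-suc e (conj-pass (suc e))

      -- On arrangements: carrying the last entry to the front and applying generator 0 amounts to
      -- changing its sign in place and then carrying it to position `k₀`.
      conj-zero : ∀ e w → down 0 (k₀ + e) ++ 0 ∷ w ~ conj e ++ down k₀ e ++ w
      conj-zero zero w = subst (λ k → down 0 k ++ 0 ∷ w ~ base ++ w) (sym (+-identityʳ k₀)) (base-zero w)
      conj-zero (suc e) w rewrite +-suc k₀ e = begin
        b ∷ down 0 (k₀ + e) ++ 0 ∷ w           ≈⟨ ∷ˡ b (conj-zero e w) ⟩
        b ∷ conj e ++ down k₀ e ++ w           ≈⟨ ++ˡ (b ∷ conj e) (square b _) ⟨
        b ∷ conj e ++ b ∷ b ∷ down k₀ e ++ w   ≡⟨ conj-++ e _ ⟨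
        conj (suc e) ++ b ∷ down k₀ e ++ w ∎
        where b = suc (k₀ + e)


      signWord : ℕ → Bool → List ℕ
      signWord n false = []
      signWord n true = conj (n ∸ k₀)

      -- Representatives of the right cosets of the parabolic subgroup of rank `n` in that of rank
      -- `n + 1`: choose the sign of the value `n`, then its position.
      coset : ∀ n → Bool → ℕ → List ℕ
      coset n σ p = signWord n σ ++ down p (n ∸ p)

      signWord-pass : ∀ {n σ i} → n < N → σ ∈ signs n → Gen n i →
        ∃ λ i' → Gen n i' × (∀ w → signWord n σ ++ i ∷ w ~ i' ∷ signWord n σ ++ w)
      signWord-pass {σ = false} {i} n<N σ∈ g = i , g , λ w → ~-refl
      signWord-pass {n} {σ = true} {i} n<N σ∈ g with m≤n⇒∃[o]m+o≡n (signs-true σ∈)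
      ... | e , refl rewrite m+n∸m≡n k₀ e = θ i , θ-generator _ i g , conj-pass e i n<N g

      zero-move : ∀ {n p} → p ≤ k₀ → k₀ ≤ n →
        ∃ λ p' → p' ≤ n × (∀ w → down p (n ∸ p) ++ 0 ∷ w ~ signWord n true ++ down p' (n ∸ p') ++ w)
      zero-move {p = p} p≤k₀ k₀≤n with m≤n⇒∃[o]m+o≡n k₀≤n
      ... | e , refl rewrite m+n∸m≡n k₀ e = go p p≤k₀
        where
        n = k₀ + e
        go : ∀ p → p ≤ k₀ → ∃ λ p' → p' ≤ n × (∀ w → down p (n ∸ p) ++ 0 ∷ w ~ conj e ++ down p' (n ∸ p') ++ w)
        go zero _ = k₀ , m≤m+n k₀ e , subst (λ d → ∀ w → down 0 n ++ 0 ∷ w ~ conj e ++ down k₀ d ++ w) (sym (m+n∸m≡n k₀ e)) (conj-zero e)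
        -- Here `suc p` equals `k₀`, and `conj-zero` is read backwards, both `conj e` and generator
        -- 0 being involutions.
        go (suc p) p<k₀ = 0 , z≤n , λ w → begin
          down (suc p) (n ∸ suc p) ++ 0 ∷ w         ≡⟨ cong (_++ 0 ∷ w) (trans
            (cong (λ q → down q (n ∸ q)) (≤-antisym p<k₀ (≤-trans k₀≤1 (s≤s z≤n)))) (cong (down k₀) (m+n∸m≡n k₀ e))) ⟩
          down k₀ e ++ 0 ∷ w                        ≈⟨ conj-square e _ ⟨
          conj e ++ conj e ++ down k₀ e ++ 0 ∷ w    ≈⟨ ++ˡ (conj e) (conj-zero e (0 ∷ w)) ⟨
          conj e ++ down 0 n ++ 0 ∷ 0 ∷ w           ≈⟨ ++ˡ (conj e) (++ˡ (down 0 n) (square 0 w)) ⟩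
          conj e ++ down 0 n ++ w ∎

      Moves Passes : ℕ → Bool → ℕ → ℕ → Set
      Moves n σ p i = ∃ λ σ' → ∃ λ p' → (σ' ∈ signs n × p' ≤ n) × (∀ w → coset n σ p ++ i ∷ w ~ coset n σ' p' ++ w)
      Passes n σ p i = ∃ λ i' → Gen n i' × (∀ w → coset n σ p ++ i ∷ w ~ i' ∷ coset n σ p ++ w)

      -- The dichotomy for coset representatives: a generator either leads to another representative
      -- or comes out on the left as a generator of smaller rank. It keeps the normal words closed
      -- under right multiplication without any use of length.
      coset-step : ∀ {n σ p i} → n < N → σ ∈ signs n → p ≤ n → Gen (suc n) i → Moves n σ p i ⊎ Passes n σ p i
      coset-step {n} {σ} {p} {i} n<N σ∈ p≤n g = step i g
        where
        pass : ∀ {i i'} → Gen n i' → (∀ w → down p (n ∸ p) ++ i ∷ w ~ i' ∷ down p (n ∸ p) ++ w) →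
          Passes n σ p i
        pass {i} {i'} g' e with signWord-pass n<N σ∈ g'
        ... | i″ , g″ , e' = i″ , g″ , λ w → begin
          coset n σ p ++ i ∷ w                      ≡⟨ ++-assoc (signWord n σ) _ _ ⟩
          signWord n σ ++ down p (n ∸ p) ++ i ∷ w   ≈⟨ ++ˡ (signWord n σ) (e w) ⟩
          signWord n σ ++ i' ∷ down p (n ∸ p) ++ w  ≈⟨ e' _ ⟩
          i″ ∷ signWord n σ ++ down p (n ∸ p) ++ w  ≡⟨ cong (i″ ∷_) (++-assoc (signWord n σ) _ _) ⟨
          i″ ∷ coset n σ p ++ w ∎
        step : ∀ i → Gen (suc n) i → Moves n σ p i ⊎ Passes n σ p i
        step (suc i) g with down-step p (n ∸ p) i (subst (_< N) (sym (m+[n∸m]≡n p≤n)) n<N)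
                              (subst (suc i ≤_) (sym (m+[n∸m]≡n p≤n)) (s≤s⁻¹ g))
        ... | inj₂ (i' , i'< , e) = inj₂ (pass (subst (suc i' <_) (m+[n∸m]≡n p≤n) i'<) e)
        ... | inj₁ (p' , d' , eq , e) = inj₁ (σ , p' , (σ∈ , ≤-trans (m≤m+n p' d') (≤-reflexive eq')) , λ w → begin
          coset n σ p ++ suc i ∷ w                      ≡⟨ ++-assoc (signWord n σ) _ _ ⟩
          signWord n σ ++ down p (n ∸ p) ++ suc i ∷ w   ≈⟨ ++ˡ (signWord n σ) (e w) ⟩
          signWord n σ ++ down p' d' ++ w               ≡⟨ cong (λ d → signWord n σ ++ down p' d ++ w)
                                                             (trans (sym (m+n∸m≡n p' d')) (cong (_∸ p') eq')) ⟩
          signWord n σ ++ down p' (n ∸ p') ++ w         ≡⟨ ++-assoc (signWord n σ) _ _ ⟨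
          coset n σ p' ++ w ∎)
          where
          eq' : p' + d' ≡ n
          eq' = trans eq (m+[n∸m]≡n p≤n)
        -- If `p` exceeds `k₀`, generator 0 commutes with every letter of the run; otherwise it
        -- toggles the sign of the value `n`.
        step zero g with p ≤? k₀
        ... | no p≰k₀ = inj₂ (pass {zero} {zero} (<-≤-trans (≰⇒> p≰k₀) p≤n) (commuteWord (All.map
                (λ { (j , refl , p≤j , _) → commute-sym (commute (mat₀-far j (<-≤-trans (≰⇒> p≰k₀) p≤j))) }) (down-letters p (n ∸ p)))))
        ... | yes p≤k₀ with zero-move {n} p≤k₀ (s≤s⁻¹ g)
        ...   | p' , p'≤n , e = inj₁ (not σ , p' , (signs-all (s≤s⁻¹ g) _ , p'≤n) , λ w → begin
          coset n σ p ++ 0 ∷ w                                    ≡⟨ ++-assoc (signWord n σ) _ _ ⟩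
          signWord n σ ++ down p (n ∸ p) ++ 0 ∷ w                 ≈⟨ ++ˡ (signWord n σ) (e w) ⟩
          signWord n σ ++ signWord n true ++ down p' (n ∸ p') ++ w ≈⟨ toggle σ _ ⟩
          signWord n (not σ) ++ down p' (n ∸ p') ++ w             ≡⟨ ++-assoc (signWord n (not σ)) _ _ ⟨
          coset n (not σ) p' ++ w ∎)
          where
          toggle : ∀ σ w → signWord n σ ++ signWord n true ++ w ~ signWord n (not σ) ++ w
          toggle false w = ~-refl
          toggle true w = conj-square (n ∸ k₀) w

      normalWord : ∀ {n} → Code n → List ℕ
      normalWord [] = []
      normalWord {suc n} ((σ , p) ∷ x) = normalWord x ++ coset n σ p

      normalWord-step : ∀ {n} (x : Code n) i → n ≤ N → Valid x → Gen n i →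
        ∃ λ (y : Code n) → Valid y × (∀ w → normalWord x ++ i ∷ w ~ normalWord y ++ w)
      normalWord-step [] zero _ _ ()
      normalWord-step [] (suc i) _ _ ()
      normalWord-step {suc n} ((σ , p) ∷ x) i n<N ((σ∈ , p≤) , v) g with coset-step n<N σ∈ p≤ g
      ... | inj₁ (σ' , p' , ok , e) = ((σ' , p') Vec.∷ x) , (ok , v) , λ w → begin
        (normalWord x ++ coset n σ p) ++ i ∷ w  ≡⟨ ++-assoc (normalWord x) _ _ ⟩
        normalWord x ++ coset n σ p ++ i ∷ w    ≈⟨ ++ˡ (normalWord x) (e w) ⟩
        normalWord x ++ coset n σ' p' ++ w      ≡⟨ ++-assoc (normalWord x) _ _ ⟨
        (normalWord x ++ coset n σ' p') ++ w ∎
      ... | inj₂ (i' , g' , e) with normalWord-step x i' (≤-trans (n≤1+n n) n<N) v g'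
      ...   | y , vy , e' = ((σ , p) Vec.∷ y) , ((σ∈ , p≤) , vy) , λ w → begin
        (normalWord x ++ coset n σ p) ++ i ∷ w  ≡⟨ ++-assoc (normalWord x) _ _ ⟩
        normalWord x ++ coset n σ p ++ i ∷ w    ≈⟨ ++ˡ (normalWord x) (e w) ⟩
        normalWord x ++ i' ∷ coset n σ p ++ w   ≈⟨ e' _ ⟩
        normalWord y ++ coset n σ p ++ w        ≡⟨ ++-assoc (normalWord y) _ _ ⟨
        (normalWord y ++ coset n σ p) ++ w ∎

    down-Gen : ∀ {n p d} → p + d ≤ n → All (Gen (suc n)) (down p d)
    down-Gen {n} {p} {d} h = All.map (λ { (j , refl , _ , j<) → s≤s (≤-trans j< h) }) (down-letters p d)

    signWord-Gen : ∀ {n σ} → σ ∈ signs n → All (Gen (suc n)) (signWord n σ)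
    signWord-Gen {σ = false} _ = []
    signWord-Gen {n} {σ = true} σ∈ = subst (λ k → All (Gen (suc k)) (conj (n ∸ k₀))) (m+[n∸m]≡n (signs-true σ∈)) (conj-letters (n ∸ k₀))

    normalWord-Gen : ∀ {n} (x : Code n) → Valid x → All (Gen n) (normalWord x)
    normalWord-Gen [] _ = []
    normalWord-Gen {suc n} ((σ , p) ∷ x) ((σ∈ , p≤) , v) =
      AllP.++⁺ (All.map (λ {i} → Gen-mono i (n≤1+n n)) (normalWord-Gen x v))
        (AllP.++⁺ (signWord-Gen σ∈) (down-Gen (≤-reflexive (m+[n∸m]≡n p≤))))

    -- Action on signed arrangements

    acts-∷ʳ : ∀ {n u} → All (Gen n) u → (l : Vec SignedValue n) → ∀ a → acts u (l ∷ʳ a) ≡ acts u l ∷ʳ a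
    acts-∷ʳ [] l a = refl
    acts-∷ʳ {u = i ∷ u} (g ∷ gs) l a = trans (cong (acts u) (act-∷ʳ i g)) (acts-∷ʳ gs (act i l) a)
      where
      act-∷ʳ : ∀ i → Gen _ i → act i (l ∷ʳ a) ≡ act i l ∷ʳ a
      act-∷ʳ zero g = zeroAct-∷ʳ l a g
      act-∷ʳ (suc i) g = swap-∷ʳ i l a g

    acts-down-suc : ∀ p d {n} a (l : Vec SignedValue n) → acts (down (suc p) d) (a ∷ l) ≡ a ∷ acts (down p d) l
    acts-down-suc p zero a l = refl
    acts-down-suc p (suc d) a l = acts-down-suc p d a (swap (p + d) l)

    acts-down : ∀ {n} p (l : Vec SignedValue n) a → p ≤ n → acts (down p (n ∸ p)) (l ∷ʳ a) ≡ insert p a l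
    acts-down {suc n} (suc p) (b ∷ l) a (s≤s p≤n) = trans (acts-down-suc p (n ∸ p) b (l ∷ʳ a)) (cong (b ∷_) (acts-down p l a p≤n))
    acts-down zero l a _ = go l
      where
      go : ∀ {n} (l : Vec SignedValue n) → acts (down 0 n) (l ∷ʳ a) ≡ a ∷ l
      go [] = refl
      go {suc n} (b ∷ l) = trans
        -- The run is read as `down 1 n` followed by the letter 1, so that the head `b` stays in
        -- place until the last swap.
        (cong (λ u → acts u (b ∷ (l ∷ʳ a))) (trans (sym (++-identityʳ (down 0 (suc n)))) (sym (down-snoc 0 n []))))
        (trans (foldActions-++ act (down 1 n) [ 1 ] (b ∷ (l ∷ʳ a)))
          (cong (swap 0) (trans (acts-down-suc 0 n b (l ∷ʳ a)) (cong (b ∷_) (go l)))))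

    acts-conj : ∀ e {n} → n ≡ k₀ + e → (l : Vec SignedValue n) → ∀ a → acts (conj e) (l ∷ʳ a) ≡ correction l ∷ʳ negate a
    acts-conj zero eq l a with trans eq (+-identityʳ k₀)
    ... | refl = base-acts l a
    acts-conj (suc e) {n} eq l a with trans eq (+-suc k₀ e)
    ... | refl with initLast l
    ...   | l' , c , refl = begin
      acts (conj e ++ [ suc k ]) (swap k (l' ∷ʳ c ∷ʳ a))      ≡⟨ cong (acts (conj e ++ [ suc k ])) (swap-last l' c a) ⟩
      acts (conj e ++ [ suc k ]) (l' ∷ʳ a ∷ʳ c)               ≡⟨ foldActions-++ act (conj e) [ suc k ] (l' ∷ʳ a ∷ʳ c) ⟩
      swap k (acts (conj e) (l' ∷ʳ a ∷ʳ c))                   ≡⟨ cong (swap k) (acts-∷ʳ (conj-letters e) (l' ∷ʳ a) c) ⟩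
      swap k (acts (conj e) (l' ∷ʳ a) ∷ʳ c)                   ≡⟨ cong (λ x → swap k (x ∷ʳ c)) (acts-conj e refl l' a) ⟩
      swap k (correction l' ∷ʳ negate a ∷ʳ c)                 ≡⟨ swap-last (correction l') (negate a) c ⟩
      correction l' ∷ʳ c ∷ʳ negate a                          ≡⟨ cong (_∷ʳ negate a) (correction-∷ʳ l' c (m≤m+n k₀ e)) ⟨
      correction (l' ∷ʳ c) ∷ʳ negate a ∎
      where
      open ≡-Reasoning
      k = k₀ + e

    correctionIf : ∀ {n} → Bool → Vec SignedValue n → Vec SignedValue n
    correctionIf false l = l
    correctionIf true l = correction l

    acts-signWord : ∀ {n σ} → σ ∈ signs n → (l : Vec SignedValue n) →
      acts (signWord n σ) (l ∷ʳ (false , n)) ≡ correctionIf σ l ∷ʳ (σ , n)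
    acts-signWord {σ = false} _ l = refl
    acts-signWord {n} {true} σ∈ l = acts-conj (n ∸ k₀) (sym (m+[n∸m]≡n (signs-true σ∈))) l (false , n)

    signedArrangement : ∀ {n} → Code n → Vec SignedValue n
    signedArrangement [] = []
    signedArrangement {suc n} ((σ , p) ∷ x) = insert p (σ , n) (correctionIf σ (signedArrangement x))

    acts-normalWord : ∀ {n} (x : Code n) → Valid x → acts (normalWord x) (identityArrangement n) ≡ signedArrangement x
    acts-normalWord [] _ = refl
    acts-normalWord {suc n} ((σ , p) ∷ x) ((σ∈ , p≤) , v) = begin
      acts (normalWord x ++ coset n σ p) (identityArrangement n ∷ʳ (false , n))
        ≡⟨ foldActions-++ act (normalWord x) _ _ ⟩
      acts (coset n σ p) (acts (normalWord x) (identityArrangement n ∷ʳ (false , n)))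
        ≡⟨ cong (acts (coset n σ p)) (trans (acts-∷ʳ (normalWord-Gen x v) _ _) (cong (_∷ʳ (false , n)) (acts-normalWord x v))) ⟩
      acts (coset n σ p) (signedArrangement x ∷ʳ (false , n))
        ≡⟨ foldActions-++ act (signWord n σ) _ _ ⟩
      acts (down p (n ∸ p)) (acts (signWord n σ) (signedArrangement x ∷ʳ (false , n)))
        ≡⟨ cong (acts (down p (n ∸ p))) (acts-signWord σ∈ (signedArrangement x)) ⟩
      acts (down p (n ∸ p)) (correctionIf σ (signedArrangement x) ∷ʳ (σ , n))
        ≡⟨ acts-down p _ _ p≤ ⟩
      insert p (σ , n) (correctionIf σ (signedArrangement x)) ∎
      where open ≡-Reasoning

    correctionIf-values : ∀ σ {n} (l : Vec SignedValue n) → Vec.map proj₂ (correctionIf σ l) ≡ Vec.map proj₂ l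
    correctionIf-values false l = refl
    correctionIf-values true l = correction-values l

    signedArrangement-values : ∀ {n} (x : Code n) → Vec.map proj₂ (signedArrangement x) ≡ arrangement x
    signedArrangement-values [] = refl
    signedArrangement-values {suc n} ((σ , p) ∷ x) = trans (insert-map proj₂ p (σ , n) _)
      (cong (insert p n) (trans (correctionIf-values σ _) (signedArrangement-values x)))

    correctionIf-injective : ∀ σ {n} {k l : Vec SignedValue n} → correctionIf σ k ≡ correctionIf σ l → k ≡ l
    correctionIf-injective false e = e
    correctionIf-injective true {k = k} {l} e =
      trans (sym (correction-involutive k)) (trans (cong correction e) (correction-involutive l))

    -- The largest value occurs once, so its position and sign can be read off; removing it and
    -- undoing the correction leaves the arrangement of the shorter code.
    signedArrangement-injective : ∀ {n} (x y : Code n) → Valid x → Valid y →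
      signedArrangement x ≡ signedArrangement y → x ≡ y
    signedArrangement-injective [] [] _ _ _ = refl
    signedArrangement-injective {suc n} ((σ , p) ∷ x) ((τ , q) ∷ y) ((_ , p≤) , vx) ((_ , q≤) , vy) e
      with insert-injective (λ s → proj₂ s ≡ n) p q _ _ p≤ q≤ refl refl (fresh σ x) (fresh τ y) e
      where
      fresh : ∀ σ x → VAll (λ s → ¬ proj₂ s ≡ n) (correctionIf σ (signedArrangement x))
      fresh σ x = VAllP.map⁻ (subst (VAll (λ k → ¬ k ≡ n)) (sym (trans (correctionIf-values σ _) (signedArrangement-values x)))
        (VAll.map <⇒≢ (arrangement-< x)))
    ... | refl , refl , e' = cong (_ ∷_) (signedArrangement-injective x y vx vy (correctionIf-injective σ e'))

    -- The conjugating letters come in pairs. This is why `codeParity` does not depend on the signs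
    -- in a code.
    weightParity-conj : ∀ e → weightParity w₀ (conj e) ≡ false
    weightParity-conj zero = weightParity-base
    weightParity-conj (suc e) = cong not (trans (weightParity-++ w₀ (conj e) _) (cong (_xor true) (weightParity-conj e)))

    weightParity-signWord : ∀ n σ → weightParity w₀ (signWord n σ) ≡ false
    weightParity-signWord n false = refl
    weightParity-signWord n true = weightParity-conj (n ∸ k₀)

    weightParity-normalWord : ∀ {n} (x : Code n) → weightParity w₀ (normalWord x) ≡ codeParity x
    weightParity-normalWord [] = refl
    weightParity-normalWord {suc n} ((σ , p) ∷ x) = begin
      weightParity w₀ (normalWord x ++ coset n σ p)
        ≡⟨ weightParity-++ w₀ (normalWord x) _ ⟩
      weightParity w₀ (normalWord x) xor weightParity w₀ (coset n σ p)
        ≡⟨ cong₂ _xor_ (weightParity-normalWord x) (trans (weightParity-++ w₀ (signWord n σ) _)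
             (cong₂ _xor_ (weightParity-signWord n σ) (weightParity-down w₀ p (n ∸ p)))) ⟩
      codeParity x xor parity (n ∸ p)
        ≡⟨ xor-comm (codeParity x) _ ⟩
      parity (n ∸ p) xor codeParity x ∎
      where open ≡-Reasoning

    -- Passage to words over Fin N

    embed-toℕ : ∀ w → embed (map toℕ w) ≡ w
    embed-toℕ [] = refl
    embed-toℕ (i ∷ w) = cong₂ _++_ (trans (letter-< (toℕ<n i)) (cong [_] (fromℕ<-toℕ i (toℕ<n i)))) (embed-toℕ w)

    toℕ-embed : ∀ {u} → All (_< N) u → map toℕ (embed u) ≡ u
    toℕ-embed [] = refl
    toℕ-embed {i ∷ u} (i<N ∷ u<N) = trans (map-++ toℕ (letter i) (embed u))
      (cong₂ _++_ (trans (cong (map toℕ) (letter-< i<N)) (cong [_] (toℕ-fromℕ< i<N))) (toℕ-embed u<N))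

    toℕ-alt : ∀ (i j : Fin N) k → map toℕ (alt i j k) ≡ alternating (toℕ i) (toℕ j) k
    toℕ-alt i j zero = refl
    toℕ-alt i j (suc k) = cong (toℕ i ∷_) (toℕ-alt j i k)

    wordParity : Word N → Bool
    wordParity w = weightParity w₀ (map toℕ w)

    wordParity-resp : ∀ {u v} → WordEq M u v → wordParity u ≡ wordParity v
    wordParity-resp weq-refl = refl
    wordParity-resp (weq-sym e) = sym (wordParity-resp e)
    wordParity-resp (weq-trans e f) = trans (wordParity-resp e) (wordParity-resp f)
    wordParity-resp (weq-rel u v i j) = begin
      wordParity (u ++ r ++ v)                        ≡⟨ split u (r ++ v) ⟩
      wordParity u xor wordParity (r ++ v)            ≡⟨ cong (wordParity u xor_) (split r v) ⟩
      wordParity u xor (wordParity r xor wordParity v) ≡⟨ cong (λ z → wordParity u xor (z xor wordParity v))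
                                                           (trans (cong (weightParity w₀) (toℕ-alt i j (2 * M i j)))
                                                             (weightParity-relator (toℕ i) (toℕ j))) ⟩
      wordParity u xor wordParity v                   ≡⟨ split u v ⟨
      wordParity (u ++ v) ∎
      where
      open ≡-Reasoning
      r = alt i j (2 * M i j)
      split : ∀ u v → wordParity (u ++ v) ≡ wordParity u xor wordParity v
      split u v = trans (cong (weightParity w₀) (map-++ toℕ u v)) (weightParity-++ w₀ (map toℕ u) _)

    wordAct : Word N → Vec SignedValue N → Vec SignedValue N
    wordAct w = acts (map toℕ w)

    wordAct-++ : ∀ u v l → wordAct (u ++ v) l ≡ wordAct v (wordAct u l)
    wordAct-++ u v l = trans (cong (λ x → acts x l) (map-++ toℕ u v)) (foldActions-++ act (map toℕ u) _ l)

    wordAct-resp : ∀ {u v} → WordEq M u v → ∀ l → wordAct u l ≡ wordAct v l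
    wordAct-resp weq-refl l = refl
    wordAct-resp (weq-sym e) l = sym (wordAct-resp e l)
    wordAct-resp (weq-trans e f) l = trans (wordAct-resp e l) (wordAct-resp f l)
    wordAct-resp (weq-rel u v i j) l = begin
      wordAct (u ++ r ++ v) l              ≡⟨ wordAct-++ u (r ++ v) l ⟩
      wordAct (r ++ v) (wordAct u l)       ≡⟨ wordAct-++ r v _ ⟩
      wordAct v (wordAct r (wordAct u l))  ≡⟨ cong (wordAct v) (trans (cong (λ x → acts x (wordAct u l)) (toℕ-alt i j (2 * M i j)))
                                                (acts-relator (toℕ i) (toℕ j) (toℕ<n i) (toℕ<n j) _)) ⟩
      wordAct v (wordAct u l)              ≡⟨ wordAct-++ u v l ⟨
      wordAct (u ++ v) l ∎
      where
      open ≡-Reasoning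
      r = alt i j (2 * M i j)

    wordArrangement : Word N → Vec ℕ N
    wordArrangement w = Vec.map proj₂ (wordAct w (identityArrangement N))

    wordArrangement-resp : ∀ {u v} → WordEq M u v → wordArrangement u ≡ wordArrangement v
    wordArrangement-resp e = cong (Vec.map proj₂) (wordAct-resp e (identityArrangement N))

    wordAct-embed : ∀ {u} → All (_< N) u → ∀ l → wordAct (embed u) l ≡ acts u l
    wordAct-embed u<N l = cong (λ x → acts x l) (toℕ-embed u<N)

    normalForm : Code N → Word N
    normalForm x = embed (normalWord x)

    normalWord-< : ∀ {x : Code N} → Valid x → All (_< N) (normalWord x)
    normalWord-< {x} v = All.map (λ {i} → Gen-< i) (normalWord-Gen x v)

    normalForm-act : ∀ {x} → Valid x → wordAct (normalForm x) (identityArrangement N) ≡ signedArrangement x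
    normalForm-act {x} v = trans (wordAct-embed (normalWord-< v) _) (acts-normalWord x v)

    normalForm-injective : ∀ {x y} → Valid x → Valid y → WordEq M (normalForm x) (normalForm y) → x ≡ y
    normalForm-injective {x} {y} vx vy e = signedArrangement-injective x y vx vy
      (trans (sym (normalForm-act vx)) (trans (wordAct-resp e _) (normalForm-act vy)))

    elements : List (Word N)
    elements = map normalForm (codes N)

    elements-distinct : Distinct M elements
    elements-distinct = AllPairsP.map⁺ (go (All.tabulate codes-valid) (codes-unique signs-unique N))
      where
      go : ∀ {xs} → All Valid xs → Unique xs → AllPairs (λ x y → ¬ WordEq M (normalForm x) (normalForm y)) xs
      go [] [] = []
      go (v ∷ vs) (x# ∷ u) = All.zipWith (λ { (vy , x≢y) e → x≢y (normalForm-injective v vy e) }) (vs , x# ) ∷ go vs u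

    signed-elements : ∀ (f : Bool → Vec ℕ N → ℤ) →
      Σ[ elements ] (λ e → f (wordParity e) (wordArrangement e)) ≡ Σ[ codes N ] (λ x → f (codeParity x) (arrangement x))
    signed-elements f = trans (Σ-map normalForm (codes N) _) (Σ-cong (codes N) λ {x} x∈ → cong₂ f
      (trans (cong (weightParity w₀) (toℕ-embed (normalWord-< (codes-valid x∈)))) (weightParity-normalWord x))
      (trans (cong (Vec.map proj₂) (normalForm-act (codes-valid x∈))) (signedArrangement-values x)))

    wordParity-snoc : ∀ w i {k} → toℕ i ≡ suc k → wordParity (w ++ [ i ]) ≡ not (wordParity w)
    wordParity-snoc w i {k} e rewrite map-++ toℕ w [ i ] | e =
      trans (weightParity-++ w₀ (map toℕ w) [ suc k ]) (xor-comm _ true)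

    wordArrangement-snoc : ∀ w i {k} → toℕ i ≡ suc k → wordArrangement (w ++ [ i ]) ≡ swap k (wordArrangement w)
    wordArrangement-snoc w i {k} e rewrite wordAct-++ w [ i ] (identityArrangement N) | e = swap-map proj₂ k _

    -- The generators suc (level b j) commute pairwise.
    cubeWord : ∀ b m → Vec Bool m → List ℕ
    cubeWord b zero [] = []
    cubeWord b (suc m) (false ∷ v) = cubeWord b m v
    cubeWord b (suc m) (true ∷ v) = suc (level b m) ∷ cubeWord b m v

    cubeWord-letters : ∀ b m v → All (λ i → ∃ λ k → i ≡ suc k × suc (suc k) ≤ level b m) (cubeWord b m v)
    cubeWord-letters b zero [] = []
    cubeWord-letters b (suc m) (x ∷ v) = extend x
      where
      weaken : All (λ i → ∃ λ k → i ≡ suc k × suc (suc k) ≤ level b (suc m)) (cubeWord b m v)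
      weaken = All.map (λ { (k , e , h) → k , e , ≤-trans h (≤-trans (n≤1+n _) (n≤1+n _)) }) (cubeWord-letters b m v)
      extend : ∀ x → All (λ i → ∃ λ k → i ≡ suc k × suc (suc k) ≤ level b (suc m)) (cubeWord b (suc m) (x ∷ v))
      extend false = weaken
      extend true = (level b m , refl , ≤-refl) ∷ weaken

    cubeWord-commute : ∀ b m v → CommuteWord (cubeWord b m v) (suc (level b m))
    cubeWord-commute b m v = commuteWord (All.map (λ { (k , refl , h) → commute-far h }) (cubeWord-letters b m v))

    cubeWord-edge : ∀ b m v i → ∃ λ k → suc (suc k) ≤ level b m × cubeWord b m (updateAt v i not) ~ cubeWord b m v ++ [ suc k ]
    cubeWord-edge b (suc m) (false ∷ v) zero = level b m , ≤-refl ,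
      ~-sym (~-trans (cubeWord-commute b m v []) (~-reflexive (cong (suc (level b m) ∷_) (++-identityʳ _))))
    cubeWord-edge b (suc m) (true ∷ v) zero = level b m , ≤-refl ,
      ~-sym (~-trans (∷ˡ _ (cubeWord-commute b m v [])) (~-trans (square _ _) (~-reflexive (++-identityʳ _))))
    cubeWord-edge b (suc m) (x ∷ v) (suc i) with cubeWord-edge b m v i
    ... | k , h , e = k , ≤-trans h (≤-trans (n≤1+n _) (n≤1+n _)) , extend x
      where
      extend : ∀ x → cubeWord b (suc m) (x ∷ updateAt v i not) ~ cubeWord b (suc m) (x ∷ v) ++ [ suc k ]
      extend false = e
      extend true = ∷ˡ _ e

    -- The top generator affects only the last two entries and the lower ones never reach them, so
    -- the order of these entries reveals the top bit and the prefix reveals the rest.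
    cubeWord-injective : ∀ b m v v' → acts (cubeWord b m v) (identityArrangement (level b m)) ≡
      acts (cubeWord b m v') (identityArrangement (level b m)) → v ≡ v'
    cubeWord-injective b zero [] [] _ = refl
    cubeWord-injective b (suc m) (x ∷ v) (y ∷ v') e = cong₂ _∷_ (head x y tops) (cubeWord-injective b m v v' rest)
      where
      n = level b m
      first second : Bool → SignedValue
      first false = false , n
      first true = false , suc n
      second false = false , suc n
      second true = false , n
      lower-act : ∀ v p q → acts (cubeWord b m v) (identityArrangement n ∷ʳ p ∷ʳ q) ≡
        acts (cubeWord b m v) (identityArrangement n) ∷ʳ p ∷ʳ q
      lower-act v p q = trans (acts-∷ʳ (All.map (λ { (k , refl , h) → m≤n⇒m≤1+n h }) (cubeWord-letters b m v)) _ q)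
        (cong (_∷ʳ q) (acts-∷ʳ (All.map (λ { (k , refl , h) → h }) (cubeWord-letters b m v)) _ p))
      eval : ∀ x v → acts (cubeWord b (suc m) (x ∷ v)) (identityArrangement (level b (suc m))) ≡
        acts (cubeWord b m v) (identityArrangement n) ∷ʳ first x ∷ʳ second x
      eval false v = lower-act v _ _
      eval true v = trans (cong (acts (cubeWord b m v)) (swap-last (identityArrangement n) _ _)) (lower-act v _ _)
      outer = ∷ʳ-injective _ _ (trans (sym (eval x v)) (trans e (eval y v')))
      tops : second x ≡ second y
      tops = proj₂ outer
      rest = proj₁ (∷ʳ-injective _ _ (proj₁ outer))
      head : ∀ x y → second x ≡ second y → x ≡ y
      head false false _ = refl
      head true true _ = refl
      head false true e = ⊥-elim (1+n≢n (cong proj₂ e))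
      head true false e = ⊥-elim (1+n≢n (sym (cong proj₂ e)))

    cube : ∀ b m → N ≡ level b m → HasHypercube M m
    cube b m N≡ = (λ v → embed (cubeWord b m v)) , injective , λ { v .(updateAt v i not) (i , refl) → edge v i }
      where
      letters-< : ∀ v → All (_< N) (cubeWord b m v)
      letters-< v = All.map (λ { (k , refl , h) → subst (suc k <_) (sym N≡) h }) (cubeWord-letters b m v)
      injective : ∀ v v' → WordEq M (embed (cubeWord b m v)) (embed (cubeWord b m v')) → v ≡ v'
      injective v v' e = cubeWord-injective b m v v'
        (subst (λ n → acts (cubeWord b m v) (identityArrangement n) ≡ acts (cubeWord b m v') (identityArrangement n)) N≡
          (trans (sym (wordAct-embed (letters-< v) _)) (trans (wordAct-resp e _) (wordAct-embed (letters-< v') _))))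
      edge : ∀ v i → Adj M (embed (cubeWord b m v)) (embed (cubeWord b m (updateAt v i not)))
      edge v i with cubeWord-edge b m v i
      ... | k , h , e = fromℕ< k<N , subst (WordEq M _) (trans (embed-++ (cubeWord b m v) [ suc k ])
              (cong (embed (cubeWord b m v) ++_) (trans (++-identityʳ _) (letter-< k<N)))) (weq e)
        where
        k<N : suc k < N
        k<N = subst (suc k <_) (sym N≡) h

    module _ (all-generators : ∀ i → i < N → Gen N i) where

      normalise : ∀ (x : Code N) → Valid x → ∀ w → ∃ λ y → Valid y × WordEq M (normalForm x ++ w) (normalForm y)
      normalise x v [] = x , v , subst (WordEq M _) (++-identityʳ _) weq-refl
      normalise x v (i ∷ w) with normalWord-step x (toℕ i) ≤-refl v (all-generators (toℕ i) (toℕ<n i))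
      ... | y , vy , e with normalise y vy w
      ...   | z , vz , e' = z , vz , weq-trans (subst₂ (WordEq M) (word x (i ∷ w)) (word y w) (weq (e (map toℕ w)))) e'
        where
        word : ∀ x w → embed (normalWord x ++ map toℕ w) ≡ normalForm x ++ w
        word x w = trans (embed-++ (normalWord x) _) (cong (normalForm x ++_) (embed-toℕ w))

      elements-complete : ∀ w → ∃ λ e → e ∈ elements × WordEq M w e
      elements-complete w = go (identityCode N)
        where
        identityCode : ∀ n → ∃ λ (x : Code n) → Valid x × normalWord x ≡ []
        identityCode zero = [] , tt , refl
        identityCode (suc n) with identityCode n
        ... | x , v , e = ((false , n) Vec.∷ x) , ((signs-false n , ≤-refl) , v) ,
              trans (cong (normalWord x ++_) (cong (down n) (n∸n≡0 n))) (trans (++-identityʳ _) e)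
        go : (∃ λ (x : Code N) → Valid x × normalWord x ≡ []) → ∃ λ e → e ∈ elements × WordEq M w e
        go (x , v , e) with normalise x v w
        ... | y , vy , eq = normalForm y , ∈-map⁺ normalForm (valid-codes vy) ,
              subst (λ u → WordEq M (u ++ w) (normalForm y)) (cong embed e) eq

      SignedSum : ℕ → ℕ → ℕ → Set
      SignedSum b m n = ∃ λ C → 0ℤ ℤ.< C ×
        (∀ G → Σ[ codes n ] (λ x → sign (codeParity x) ℤ.* G (Bits.bits b m (arrangement x))) ≡ C ℤ.* altSum m G)

      codes-sum : ∀ b m → b ≤ 1 → N ≡ level b m → SignedSum b m N
      codes-sum b m b≤1 N≡ = subst (SignedSum b m) (sym N≡) (signedSum signs-nonempty b b≤1 m)

      elements-sum : ∀ b m → SignedSum b m N → ∃ λ C → 0ℤ ℤ.< C ×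
        (∀ G → Σ[ elements ] (λ e → sign (wordParity e) ℤ.* G (Bits.bits b m (wordArrangement e))) ≡ C ℤ.* altSum m G)
      elements-sum b m (C , C>0 , s) = C , C>0 , λ G → trans (signed-elements (λ t l → sign t ℤ.* G (Bits.bits b m l))) (s G)

      tower-bound : ∀ b m → b ≤ 1 → N ≡ level b (suc m) → Bound M
      tower-bound b m b≤1 N≡ = Deduction.bound M b m elements elements-distinct elements-complete
        wordParity wordParity-resp wordArrangement wordArrangement-resp wordParity-snoc wordArrangement-snoc
        (λ i → mat-diag (toℕ i)) (fromℕ< 1<N) (toℕ-fromℕ< 1<N)
        (elements-sum b (suc m) (codes-sum b (suc m) b≤1 N≡)) (cube b (suc m) N≡)
        where
        1<N : 1 < N
        1<N = subst (1 <_) (sym N≡) (s≤s (s≤s z≤n))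

-- Types B and D as instances

mB-suc : ∀ i j → mBℕ (suc i) (suc j) ≡ mA i j
mB-suc zero j = refl
mB-suc (suc i) j = refl

mB-diag : ∀ i → mBℕ i i ≡ 1
mB-diag zero = refl
mB-diag (suc i) = trans (mB-suc i i) (mA-diag i)

mD-suc : ∀ i j → mDℕ (suc i) (suc j) ≡ mA i j
mD-suc zero j = refl
mD-suc (suc zero) j = refl
mD-suc (suc (suc i)) j = refl

mD-diag : ∀ i → mDℕ i i ≡ 1
mD-diag zero = refl
mD-diag (suc i) = trans (mD-suc i i) (mA-diag i)

negate-involutive : ∀ a → negate (negate a) ≡ a
negate-involutive (σ , k) = cong (_, k) (not-involutive σ)

negateHead : ∀ {n} → Vec SignedValue n → Vec SignedValue n
negateHead [] = []
negateHead (a ∷ l) = negate a ∷ l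

negateHead-involutive : ∀ {n} (l : Vec SignedValue n) → negateHead (negateHead l) ≡ l
negateHead-involutive [] = refl
negateHead-involutive (a ∷ l) = cong (_∷ l) (negate-involutive a)

negateHead-values : ∀ {n} (l : Vec SignedValue n) → Vec.map proj₂ (negateHead l) ≡ Vec.map proj₂ l
negateHead-values [] = refl
negateHead-values (a ∷ l) = refl

negateHead-∷ʳ : ∀ {n} (l : Vec SignedValue n) a → 0 < n → negateHead (l ∷ʳ a) ≡ negateHead l ∷ʳ a
negateHead-∷ʳ (b ∷ l) a _ = refl

swapNegate : ∀ {n} → Vec SignedValue n → Vec SignedValue n
swapNegate (a ∷ b ∷ l) = negate b ∷ negate a ∷ l
swapNegate (a ∷ []) = a ∷ []
swapNegate [] = []

swapNegate-∷ʳ : ∀ {n} (l : Vec SignedValue n) a → 1 < n → swapNegate (l ∷ʳ a) ≡ swapNegate l ∷ʳ a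
swapNegate-∷ʳ (b ∷ c ∷ l) a (s≤s (s≤s _)) = refl

acts-suc-suc : ∀ {n} (f : Vec SignedValue n → Vec SignedValue n) k i j l →
  foldActions (generatorAct f) (alternating (suc i) (suc j) k) l ≡ swaps (alternating i j k) l
acts-suc-suc f zero i j l = refl
acts-suc-suc f (suc k) i j l = acts-suc-suc f k j i (swap i l)

weightParity-suc-suc : ∀ w₀ i j k → weightParity w₀ (alternating (suc i) (suc j) (2 * k)) ≡ false
weightParity-suc-suc w₀ i j k = trans (weightParity-alternating w₀ i j (2 * k)) (parity-double k)

level-of : ∀ n → 2 ≤ n → ∃ λ b → ∃ λ m → b ≤ 1 × n ≡ level b (suc m)
level-of (suc zero) (s≤s ())
level-of (suc (suc zero)) _ = 0 , 0 , z≤n , refl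
level-of (suc (suc (suc zero))) _ = 1 , 0 , ≤-refl , refl
level-of (suc (suc (suc (suc n)))) _ with level-of (suc (suc n)) (s≤s (s≤s z≤n))
... | b , m , b≤1 , e = b , suc m , b≤1 , cong (λ k → suc (suc k)) e

module TypeB (N : ℕ) where

  open Words N mBℕ mB-diag mB-suc

  action : Action 0 [ 0 ]
  action = record
    { zeroAct = negateHead
    ; correction = id
    ; zeroAct-∷ʳ = negateHead-∷ʳ
    ; correction-∷ʳ = λ _ _ _ → refl
    ; correction-involutive = λ _ → refl
    ; correction-values = λ _ → refl
    ; base-acts = λ { [] a → refl }
    }

  open Action action

  acts-relator : ∀ i j → i < N → j < N → (l : Vec SignedValue N) → acts (alternating i j (2 * mBℕ i j)) l ≡ l
  acts-relator zero zero _ _ l = negateHead-involutive l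
  acts-relator zero (suc zero) _ (s≤s (s≤s _)) (a ∷ b ∷ l) =
    cong₂ (λ a b → a ∷ b ∷ l) (negate-involutive a) (negate-involutive b)
  acts-relator zero (suc (suc j)) _ (s≤s _) (a ∷ l) = cong₂ _∷_ (negate-involutive a) (swap-involutive j l)
  acts-relator (suc zero) zero (s≤s (s≤s _)) _ (a ∷ b ∷ l) =
    cong₂ (λ a b → a ∷ b ∷ l) (negate-involutive a) (negate-involutive b)
  acts-relator (suc (suc i)) zero (s≤s _) _ (a ∷ l) = cong₂ _∷_ (negate-involutive a) (swap-involutive i l)
  acts-relator (suc i) (suc j) i<N j<N l rewrite mB-suc i j =
    trans (acts-suc-suc negateHead (2 * mA i j) i j l) (swaps-relator i j l i<N j<N)

  -- Generator 0 has weight `false` because it changes a sign without moving any value.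
  weightParity-relator : ∀ i j → weightParity false (alternating i j (2 * mBℕ i j)) ≡ false
  weightParity-relator zero zero = refl
  weightParity-relator zero (suc zero) = refl
  weightParity-relator zero (suc (suc j)) = refl
  weightParity-relator (suc zero) zero = refl
  weightParity-relator (suc (suc i)) zero = refl
  weightParity-relator (suc i) (suc j) = weightParity-suc-suc false i j (mBℕ (suc i) (suc j))

  -- The relation of order 4 between generators 0 and 1 says precisely that 0 commutes with its
  -- conjugate by 1.
  base-pass : 1 < N → ∀ i → Generator 0 1 i → ∀ w → 1 ∷ 0 ∷ 1 ∷ i ∷ w ~ i ∷ 1 ∷ 0 ∷ 1 ∷ w
  base-pass 1<N zero _ = relator-split (1 ∷ 0 ∷ 1 ∷ 0 ∷ []) (1 ∷ 0 ∷ 1 ∷ 0 ∷ []) (relator 1<N (<-trans (s≤s z≤n) 1<N) refl)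
  base-pass 1<N (suc i) (s≤s ())

  bound : 2 ≤ N → Bound (mB N)
  bound N≥2 with level-of N N≥2
  ... | b , m , b≤1 , e = Group.Tower.tower-bound N mBℕ mB-diag mB-suc 0 z≤n [ 0 ] id
    (λ { (suc j) _ → refl }) (s≤s z≤n ∷ []) (square 0) (λ w → ~-refl) base-pass (λ _ _ → refl) (λ _ _ g → g)
    action acts-relator false refl weightParity-relator (λ { zero h → h ; (suc i) h → h }) b m b≤1 e

module TypeD (N : ℕ) where

  open Words N mDℕ mD-diag mD-suc

  action : Action 1 (0 ∷ 1 ∷ [])
  action = record
    { zeroAct = swapNegate
    ; correction = negateHead
    ; zeroAct-∷ʳ = swapNegate-∷ʳ
    ; correction-∷ʳ = negateHead-∷ʳ
    ; correction-involutive = negateHead-involutive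
    ; correction-values = negateHead-values
    ; base-acts = λ { (c ∷ []) a → refl }
    }

  open Action action

  acts-relator : ∀ i j → i < N → j < N → (l : Vec SignedValue N) → acts (alternating i j (2 * mDℕ i j)) l ≡ l
  acts-relator zero zero _ _ [] = refl
  acts-relator zero zero _ _ (a ∷ []) = refl
  acts-relator zero zero _ _ (a ∷ b ∷ l) = cong₂ (λ a b → a ∷ b ∷ l) (negate-involutive a) (negate-involutive b)
  acts-relator zero (suc zero) _ (s≤s (s≤s _)) (a ∷ b ∷ l) =
    cong₂ (λ a b → a ∷ b ∷ l) (negate-involutive a) (negate-involutive b)
  acts-relator (suc zero) zero (s≤s (s≤s _)) _ (a ∷ b ∷ l) =
    cong₂ (λ a b → a ∷ b ∷ l) (negate-involutive a) (negate-involutive b)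
  acts-relator zero (suc (suc zero)) _ (s≤s (s≤s (s≤s _))) (a ∷ b ∷ c ∷ l)
    rewrite negate-involutive a | negate-involutive b | negate-involutive c = refl
  acts-relator (suc (suc zero)) zero (s≤s (s≤s (s≤s _))) _ (a ∷ b ∷ c ∷ l)
    rewrite negate-involutive a | negate-involutive b | negate-involutive c = refl
  acts-relator zero (suc (suc (suc j))) _ (s≤s (s≤s _)) (a ∷ b ∷ l)
    rewrite negate-involutive a | negate-involutive b | swap-involutive j l = refl
  acts-relator (suc (suc (suc i))) zero (s≤s (s≤s _)) _ (a ∷ b ∷ l)
    rewrite negate-involutive a | negate-involutive b | swap-involutive i l = refl
  acts-relator (suc i) (suc j) i<N j<N l rewrite mD-suc i j =
    trans (acts-suc-suc swapNegate (2 * mA i j) i j l) (swaps-relator i j l i<N j<N)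

  -- Here generator 0 has weight `true`, since on unsigned values it is the transposition of the
  -- first two entries.
  weightParity-relator : ∀ i j → weightParity true (alternating i j (2 * mDℕ i j)) ≡ false
  weightParity-relator zero zero = refl
  weightParity-relator zero (suc zero) = refl
  weightParity-relator zero (suc (suc zero)) = refl
  weightParity-relator zero (suc (suc (suc j))) = refl
  weightParity-relator (suc zero) zero = refl
  weightParity-relator (suc (suc zero)) zero = refl
  weightParity-relator (suc (suc (suc i))) zero = refl
  weightParity-relator (suc i) (suc j) = weightParity-suc-suc true i j (mDℕ (suc i) (suc j))

  -- The diagram automorphism.
  θ : ℕ → ℕ
  θ zero = 1
  θ (suc zero) = 0
  θ (suc (suc i)) = suc (suc i)

  θ-generator : ∀ n i → Generator 1 n i → Generator 1 n (θ i)
  θ-generator n zero g = g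
  θ-generator n (suc zero) g = g
  θ-generator n (suc (suc i)) g = g

  commute₀₁ : Commute 0 1
  commute₀₁ = commute refl

  base-square : ∀ w → 0 ∷ 1 ∷ 0 ∷ 1 ∷ w ~ w
  base-square w = ~-trans (∷ˡ 0 (commute-sym commute₀₁ (1 ∷ w))) (~-trans (square 0 _) (square 1 w))

  -- On arrangements the conjugating element negates the first and third entries, and negating just
  -- one of two entries turns their swap into the swap with both signs changed; so generators 0 and
  -- 1 are exchanged.
  base-pass : 2 < N → ∀ i → Generator 1 2 i → ∀ w → 2 ∷ 0 ∷ 1 ∷ 2 ∷ i ∷ w ~ θ i ∷ 2 ∷ 0 ∷ 1 ∷ 2 ∷ w
  base-pass 2<N i g w = go i g
    where
    open ~-Reasoning
    braid₀₂ : ∀ w → 0 ∷ 2 ∷ 0 ∷ w ~ 2 ∷ 0 ∷ 2 ∷ w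
    braid₀₂ = relator-split (0 ∷ 2 ∷ 0 ∷ []) (2 ∷ 0 ∷ 2 ∷ []) (relator (<-trans (s≤s z≤n) 2<N) 2<N refl)
    go : ∀ i → Generator 1 2 i → 2 ∷ 0 ∷ 1 ∷ 2 ∷ i ∷ w ~ θ i ∷ 2 ∷ 0 ∷ 1 ∷ 2 ∷ w
    go zero _ = begin
      2 ∷ 0 ∷ 1 ∷ 2 ∷ 0 ∷ w  ≈⟨ ∷ˡ 2 (commute₀₁ _) ⟩
      2 ∷ 1 ∷ 0 ∷ 2 ∷ 0 ∷ w  ≈⟨ ++ˡ (2 ∷ 1 ∷ []) (braid₀₂ w) ⟩
      2 ∷ 1 ∷ 2 ∷ 0 ∷ 2 ∷ w  ≈⟨ braid 2<N _ ⟨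
      1 ∷ 2 ∷ 1 ∷ 0 ∷ 2 ∷ w  ≈⟨ ++ˡ (1 ∷ 2 ∷ []) (commute₀₁ _) ⟨
      1 ∷ 2 ∷ 0 ∷ 1 ∷ 2 ∷ w ∎
    go (suc zero) _ = begin
      2 ∷ 0 ∷ 1 ∷ 2 ∷ 1 ∷ w  ≈⟨ ++ˡ (2 ∷ 0 ∷ []) (braid 2<N w) ⟩
      2 ∷ 0 ∷ 2 ∷ 1 ∷ 2 ∷ w  ≈⟨ braid₀₂ _ ⟨
      0 ∷ 2 ∷ 0 ∷ 1 ∷ 2 ∷ w ∎
    go (suc (suc i)) (s≤s (s≤s ()))

  bound : 3 ≤ N → Bound (mD N)
  bound N≥3 with level-of N (≤-trans (n≤1+n 2) N≥3)
  ... | b , m , b≤1 , e = Group.Tower.tower-bound N mDℕ mD-diag mD-suc 1 ≤-refl (0 ∷ 1 ∷ []) θ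
    (λ { (suc (suc j)) _ → refl ; (suc zero) (s≤s ()) }) (≤-refl ∷ ≤-refl ∷ []) base-square (commute-sym commute₀₁) base-pass
    (λ { (suc i) _ → refl }) θ-generator
    action acts-relator true refl weightParity-relator (λ { zero _ → ≤-trans (n≤1+n 2) N≥3 ; (suc i) h → h }) b m b≤1 e

theorem6p9 : (n : ℕ) → (2 ≤ n → Bound (mB n)) × (3 ≤ n → Bound (mD n))
theorem6p9 n = TypeB.bound n , TypeD.bound n
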